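{- Let $H$ be a target graph, possibly with loops, for which there is an ordering $H^1,\ldots,H^k$ of the automorphic similarity classes such that the associated automorphic similarity matrix has the increasing columns property. Suppose that for each $t\ge 2$ there exist two classes $H^{a(t)}$ and $H^{b(t)}$ such that there is at least one $H$-coloring of $P_t$ that sends one endvertex of $P_t$ to a vertex in $H^{a(t)}$ and the other endvertex to a vertex in $H^{b(t)}$. Suppose further that (for each $t\ge 2$) for all $s\ge 2$ it holds that $\hom_{v\to b(t)}(P_s,H)>\hom_{v\to a(t)}(P_s,H)$, where $v$ is one of the endvertices of $P_s$. Then $H$ is strongly Hoffman-London.
   Context: All graphs are finite. A target graph $H$ is a graph without multiple edges but possibly with loops. For a simple loopless graph $G$, an $H$-coloring of $G$ is a map $f:V(G)\to V(H)$ such that $f(u)\sim_H f(v)$ whenever $u\sim_G v$; $\hom(G,H)$ denotes the number of $H$-colorings of $G$. $\mathcal{T}_n$ is the set of all trees on $n$ vertices (up to isomorphism) and $P_n\in\mathcal{T}_n$ is the path on $n$ vertices. $H$ is strongly Hoffman-London if $\hom(P_n,H)<\hom(T_n,H)$ for all $n\ge 1$ and all $T_n\in\mathcal{T}_n\setminus\{P_n\}$. Vertices $u,v$ of $H$ are automorphically similar if some automorphism of $H$ maps $u$ to $v$; the equivalence classes of this relation are the automorphic similarity classes $H^1,\ldots,H^k$. For all $i,j$ every vertex of $H^i$ has the same number $m_{i,j}$ of neighbors in $H^j$ (a looped vertex is a neighbor of itself, counted once). The automorphic similarity matrix of $H$ relative to the ordering $H^1,\ldots,H^k$ is the $k\times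 k$ matrix with $(i,j)$-entry $m_{i,j}$. A $k\times k$ matrix $(m_{i,j})$ has the increasing columns property if for each $1\le c\le k$ and each $1\le i\le k-1$, $\sum_{j=c}^k m_{i,j}\le\sum_{j=c}^k m_{i+1,j}$. For a graph $G$ with designated vertex $v$, $\hom_{v\to i}(G,H)$ denotes the number of $H$-colorings of $G$ in which $v$ is mapped to some (arbitrary but specific) vertex of $H^i$; this number does not depend on the chosen vertex of $H^i$. -}

module Defs where

open import Level using (0ℓ)
open import Data.Nat.Base as ℕ using (ℕ; suc; _+_; _^_)
open import Data.Nat.Properties using (m≢1+n+m)
import Data.Nat.Properties as ℕₚ
open import Data.Nat.ListAction using (sum)
open import Data.Fin.Base using (Fin; zero; suc; toℕ; fromℕ; inject₁; finToFun)
open import Data.Fin.Properties using (_≟_; _≤?_; all?)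
open import Data.Fin.Permutation using (Permutation; _⟨$⟩ʳ_)
open import Data.List.Base using (allFin; filter; length; map)
open import Data.Product.Base using (∃-syntax; _×_; proj₁)
open import Data.Sum.Base using (_⊎_; inj₁; inj₂; swap)
open import Function.Bundles using (_⇔_)
open import Function.Definitions using (Injective; StrictlySurjective)
open import Relation.Binary.Core using (Rel)
open import Relation.Binary.Definitions using (Decidable; Symmetric; Irreflexive)
open import Relation.Binary.Construct.Closure.ReflexiveTransitive using (Star)
open import Relation.Binary.PropositionalEquality using (_≡_; refl)
open import Relation.Nullary using (¬_)
open import Relation.Nullary.Decidable using (_→-dec_; _×-dec_; _⊎-dec_)
import Relation.Unary as U

private
  variable
    n m h : ℕ

-- A finite graph without multiple edges, possibly with loops, on the vertex
-- set Fin n.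
record Graph (n : ℕ) : Set₁ where
  field
    Adj     : Rel (Fin n) 0ℓ
    adj?    : Decidable Adj
    adj-sym : Symmetric Adj

record SimpleGraph (n : ℕ) : Set₁ where
  field
    graph    : Graph n
  open Graph graph public
  field
    loopless : Irreflexive _≡_ Adj

open SimpleGraph using (graph)

IsIsomorphism : Graph n → Graph m → Permutation n m → Set
IsIsomorphism G G′ π =
  ∀ u v → Graph.Adj G u v ⇔ Graph.Adj G′ (π ⟨$⟩ʳ u) (π ⟨$⟩ʳ v)

_≅_ : SimpleGraph n → SimpleGraph m → Set
G ≅ G′ = ∃[ π ] IsIsomorphism (graph G) (graph G′) π

Connected : SimpleGraph n → Set
Connected G = ∀ u v → Star (SimpleGraph.Adj G) u v

-- c lists the vertices of a cycle of length 3 + ℓ in cyclic order.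
IsCycle : (G : SimpleGraph n) (ℓ : ℕ) → (Fin (3 + ℓ) → Fin n) → Set
IsCycle G ℓ c =
  Injective _≡_ _≡_ c ×
  (∀ (i : Fin (2 + ℓ)) → Adj (c (inject₁ i)) (c (suc i))) ×
  Adj (c (fromℕ (2 + ℓ))) (c zero)
  where open SimpleGraph G

Acyclic : SimpleGraph n → Set
Acyclic G = ∀ ℓ c → ¬ IsCycle G ℓ c

IsTree : SimpleGraph n → Set
IsTree G = Connected G × Acyclic G

-- P n is the path 0 — 1 — ⋯ — n-1; the endvertices of P (suc n) are zero
-- and fromℕ n.
P : ∀ n → SimpleGraph n
P n = record
  { graph = record
    { Adj     = λ i j → toℕ j ≡ suc (toℕ i) ⊎ toℕ i ≡ suc (toℕ j)
    ; adj?    = λ i j → (toℕ j ℕₚ.≟ suc (toℕ i)) ⊎-dec (toℕ i ℕₚ.≟ suc (toℕ j))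
    ; adj-sym = swap
    }
  ; loopless = λ { {i} refl (inj₁ e) → m≢1+n+m (toℕ i) {0} e
                 ; {i} refl (inj₂ e) → m≢1+n+m (toℕ i) {0} e }
  }

#Fin : {Q : U.Pred (Fin n) 0ℓ} → U.Decidable Q → ℕ
#Fin {n} Q? = length (filter Q? (allFin n))

IsColoring : SimpleGraph n → Graph h → (Fin n → Fin h) → Set
IsColoring G H f = ∀ u v → SimpleGraph.Adj G u v → Graph.Adj H (f u) (f v)

isColoring? : (G : SimpleGraph n) (H : Graph h) → U.Decidable (IsColoring G H)
isColoring? G H f =
  all? λ u → all? λ v → SimpleGraph.adj? G u v →-dec Graph.adj? H (f u) (f v)

-- The maps Fin n → Fin h are enumerated, without repetition up to pointwise
-- equality, by finToFun : Fin (h ^ n) → (Fin n → Fin h).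
hom : SimpleGraph n → Graph h → ℕ
hom {n} {h} G H = #Fin {h ^ n} λ c → isColoring? G H (finToFun c)

StronglyHoffmanLondon : Graph h → Set₁
StronglyHoffmanLondon H =
  ∀ n → 1 ℕ.≤ n → (T : SimpleGraph n) → IsTree T → ¬ (T ≅ P n) →
  hom (P n) H ℕ.< hom T H

Similar : (H : Graph h) → Rel (Fin h) 0ℓ
Similar H u v = ∃[ π ] IsIsomorphism H H π × π ⟨$⟩ʳ u ≡ v

-- An ordering H¹, …, Hᵏ of the automorphic similarity classes, given by the
-- map sending each vertex to the index of its class.
record ClassOrdering (H : Graph h) : Set where
  field
    k          : ℕ
    class      : Fin h → Fin k
    nonempty   : StrictlySurjective _≡_ class
    class-spec : ∀ u v → Similar H u v ⇔ class u ≡ class v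

  -- A specific vertex of the i-th class. The counts below that use it do
  -- not depend on which vertex of the class it is.
  rep : Fin k → Fin h
  rep i = proj₁ (nonempty i)

  similarityMatrix : Fin k → Fin k → ℕ
  similarityMatrix i j =
    #Fin λ w → Graph.adj? H (rep i) w ×-dec (class w ≟ j)

  -- hom_{v→i}(G,H)
  homAt : (G : SimpleGraph n) → Fin n → Fin k → ℕ
  homAt {n} G v i =
    #Fin {h ^ n} λ c → isColoring? G H (finToFun c) ×-dec (finToFun c v ≟ rep i)

-- The row sum ∑_{j ≥ c} r j.
tailSum : Fin n → (Fin n → ℕ) → ℕ
tailSum {n} c r = sum (map r (filter (c ≤?_) (allFin n)))

IncreasingColumns : (Fin n → Fin n → ℕ) → Set
IncreasingColumns M =
  ∀ c i i⁺ → toℕ i⁺ ≡ suc (toℕ i) → tailSum c (M i) ℕ.≤ tailSum c (M i⁺)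

{-# OPTIONS --safe #-}
module Submission where

-- Let A be the adjacency operator of H and p m = A^m 1, whose value at x counts
-- the colorings of a path with m edges and one end mapped to x. Increasing
-- columns make A preserve functions that are nondecreasing in the class, so the
-- coloring counts of all rooted trees are nondecreasing. For nondecreasing f and g,
--   ∑ f · g · p m − ∑ f · A^m g = ½ ∑ A^m(x,y) (f x − f y) (g x − g y) ≥ 0,
-- so sliding branches to the far end of a path (the Kelmans transformation of
-- Csikvári and Lin) straightens any rooted tree with e edges into a path without
-- increasing its pairing with a nondecreasing function. A tree other than a path
-- has a vertex of degree at least three; rooted there, it straightens to three paths
-- with a common end, and the classes a(t), b(t), where t − 1 is the length of one of
-- the three, make the last slide strict.

open import Defs
open import Algebra.Bundles using (CommutativeMonoid)
open import Data.Bool.Base using (true; false; if_then_else_)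
open import Data.Nat using (ℕ; zero; suc; _+_; _*_; _^_; _∸_; _>_; _≤_; _<_; z≤n; s≤s; >-nonZero)
  renaming (_≟_ to _≟ℕ_)
open import Data.Nat.Properties hiding (_≟_)
open import Data.Nat.Solver using (module +-*-Solver)
import Data.Nat.ListAction as List
open import Data.Fin using (Fin; zero; suc; toℕ; fromℕ; inject₁; inject≤; lower₁; punchIn; punchOut;
  combine; finToFun; _↑ˡ_; _↑ʳ_) renaming (_≤_ to _≤ᶠ_)
open import Data.Fin.Properties as Fin using (_≟_; any?; punchInᵢ≢i; punchIn-injective;
  punchIn-punchOut; toℕ-injective)
open import Data.Fin.Permutation using (_⟨$⟩ʳ_; insert; insert-punchIn)
import Data.Fin.Permutation as Perm
import Data.List.Base as L
open import Data.Product using (Σ-syntax; ∃-syntax; _×_; _,_; proj₁; proj₂)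
open import Data.Sum using (_⊎_; inj₁; inj₂)
open import Data.Vec.Functional using (_∷_; []; insertAt)
open import Data.Vec.Functional.Properties using (insertAt-lookup; insertAt-punchIn)
open import Function.Base using (_∘_)
open import Function.Bundles using (_⇔_; mk⇔; Equivalence; Injection)
open import Function.Definitions using (Injective)
open import Function.Properties.Inverse using (↔⇒↣)
open import Relation.Binary.Construct.Closure.ReflexiveTransitive using (Star; ε; _◅_)
open import Relation.Binary.PropositionalEquality
open import Relation.Nullary using (Dec; yes; no; does; ¬_; contradiction)
open import Relation.Nullary.Decidable using (_×-dec_; ¬?; does-⇔; dec-true; dec-false)
import Relation.Unary as U

open import Algebra.Properties.Semiring.Sum +-*-semiring
open import Algebra.Properties.CommutativeMonoid.Sum *-1-commutativeMonoid
  using () renaming (sum to product; sum-cong-≗ to product-cong; sum-remove to product-remove;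
                     ∑-distrib-+ to product-distrib-*; sum-replicate-zero to product-replicate-one)

open Equivalence using (to; from)

private
  variable
    n m h : ℕ
    A B : Set

-- Finite sums and products

𝟙 : Dec A → ℕ
𝟙 a? = if does a? then 1 else 0

𝟙-cong : A ⇔ B → (a? : Dec A) (b? : Dec B) → 𝟙 a? ≡ 𝟙 b?
𝟙-cong A⇔B a? b? = cong (if_then 1 else 0) (does-⇔ A⇔B a? b?)

𝟙-true : (a? : Dec A) → A → 𝟙 a? ≡ 1
𝟙-true a? a = cong (if_then 1 else 0) (dec-true a? a)

𝟙-false : (a? : Dec A) → ¬ A → 𝟙 a? ≡ 0
𝟙-false a? ¬a = cong (if_then 1 else 0) (dec-false a? ¬a)

𝟙-× : (a? : Dec A) (b? : Dec B) → 𝟙 (a? ×-dec b?) ≡ 𝟙 a? * 𝟙 b?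
𝟙-× a? b? with does a? | does b?
... | true  | true  = refl
... | true  | false = refl
... | false | _     = refl

module _ {a ℓ} (M : CommutativeMonoid a ℓ) where
  private
    module M = CommutativeMonoid M
    import Algebra.Properties.CommutativeMonoid.Sum M as ∑M

  -- Stated for every commutative monoid because it serves both additively, in edge counts, and
  -- multiplicatively, in the factors of a coloring weight.
  sum-single : (p : Fin n) (c : Fin n → M.Carrier) →
               ∑M.sum (λ v → if does (v ≟ p) then c v else M.ε) M.≈ c p
  sum-single {suc n} p c = begin
    ∑M.sum t                             ≈⟨ ∑M.sum-remove {i = p} t ⟩
    t p M.∙ ∑M.sum (t ∘ punchIn p)        ≡⟨ cong₂ M._∙_ at-p (∑M.sum-cong-≗ off-p) ⟩
    c p M.∙ ∑M.sum {n} (λ _ → M.ε)        ≈⟨ M.∙-congˡ (∑M.sum-replicate-zero n) ⟩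
    c p M.∙ M.ε                          ≈⟨ M.identityʳ (c p) ⟩
    c p                                  ∎
    where
    open import Relation.Binary.Reasoning.Setoid M.setoid
    t : Fin (suc n) → M.Carrier
    t v = if does (v ≟ p) then c v else M.ε
    at-p : t p ≡ c p
    at-p = cong (if_then c p else M.ε) (dec-true (p ≟ p) refl)
    off-p : ∀ v → t (punchIn p v) ≡ M.ε
    off-p v = cong (if_then c (punchIn p v) else M.ε)
                   (dec-false (punchIn p v ≟ p) (punchInᵢ≢i p v))

if-as-* : ∀ b (x : ℕ) → (if b then x else 0) ≡ (if b then 1 else 0) * x
if-as-* true  x = sym (+-identityʳ x)
if-as-* false x = refl

sum-𝟙-≟ : (p : Fin n) (c : Fin n → ℕ) → ∑[ v < n ] (𝟙 (v ≟ p) * c v) ≡ c p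
sum-𝟙-≟ p c = trans (sum-cong-≗ λ v → sym (if-as-* (does (v ≟ p)) (c v)))
                    (sum-single +-0-commutativeMonoid p c)

sum-mono-≤ : {f g : Fin n → ℕ} → (∀ i → f i ≤ g i) → sum f ≤ sum g
sum-mono-≤ {zero}  f≤g = z≤n
sum-mono-≤ {suc n} f≤g = +-mono-≤ (f≤g zero) (sum-mono-≤ (f≤g ∘ suc))

sum-mono-< : {f g : Fin n → ℕ} → (∀ i → f i ≤ g i) → ∀ i → f i < g i → sum f < sum g
sum-mono-< f≤g zero    fi<gi = +-mono-<-≤ fi<gi (sum-mono-≤ (f≤g ∘ suc))
sum-mono-< f≤g (suc i) fi<gi = +-mono-≤-< (f≤g zero) (sum-mono-< (f≤g ∘ suc) i fi<gi)

term≤sum : (f : Fin n → ℕ) (i : Fin n) → f i ≤ sum f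
term≤sum {suc n} f i = ≤-trans (m≤m+n (f i) _) (≤-reflexive (sym (sum-remove {i = i} f)))

two-terms≤sum : (f : Fin n → ℕ) {i j : Fin n} → i ≢ j → f i + f j ≤ sum f
two-terms≤sum {suc n} f {i} {j} i≢j = begin
  f i + f j                          ≡⟨ cong (λ k → f i + f k) (punchIn-punchOut i≢j) ⟨
  f i + f (punchIn i (punchOut i≢j)) ≤⟨ +-monoʳ-≤ (f i) (term≤sum (f ∘ punchIn i) (punchOut i≢j)) ⟩
  f i + sum (f ∘ punchIn i)          ≡⟨ sum-remove {i = i} f ⟨
  sum f                              ∎
  where open ≤-Reasoning

sum-splitAt : ∀ m {n} (f : Fin (m + n) → ℕ) → sum f ≡ sum (f ∘ (_↑ˡ n)) + sum (f ∘ (m ↑ʳ_))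
sum-splitAt zero    f = refl
sum-splitAt (suc m) f = trans (cong (f zero +_) (sum-splitAt m (f ∘ suc))) (sym (+-assoc (f zero) _ _))

sum-combine : ∀ m {n} (f : Fin (m * n) → ℕ) → sum f ≡ ∑[ i < m ] ∑[ j < n ] f (combine i j)
sum-combine zero        f = refl
sum-combine (suc m) {n} f = trans (sum-splitAt n f)
  (cong (sum (λ j → f (j ↑ˡ (m * n))) +_) (sum-combine m (f ∘ (n ↑ʳ_))))

-- Generalised from `allFin` to `tabulate g`: the tail of `allFin` is the tabulation of `suc`, and
-- the induction has to pass through it.
sum-filter-tabulate : {Q : U.Pred A _} (Q? : U.Decidable Q) (r : A → ℕ) (g : Fin n → A) →
  List.sum (L.map r (L.filter Q? (L.tabulate g))) ≡ ∑[ i < n ] (𝟙 (Q? (g i)) * r (g i))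
sum-filter-tabulate {n = zero}  Q? r g = refl
sum-filter-tabulate {n = suc n} Q? r g with does (Q? (g zero))
... | true  = cong₂ _+_ (sym (+-identityʳ _)) (sum-filter-tabulate Q? r (g ∘ suc))
... | false = sum-filter-tabulate Q? r (g ∘ suc)

length-filter-tabulate : {Q : U.Pred A _} (Q? : U.Decidable Q) (g : Fin n → A) →
  L.length (L.filter Q? (L.tabulate g)) ≡ ∑[ i < n ] 𝟙 (Q? (g i))
length-filter-tabulate {n = zero}  Q? g = refl
length-filter-tabulate {n = suc n} Q? g with does (Q? (g zero))
... | true  = cong suc (length-filter-tabulate Q? (g ∘ suc))
... | false = length-filter-tabulate Q? (g ∘ suc)

#Fin-as-sum : {Q : U.Pred (Fin n) _} (Q? : U.Decidable Q) → #Fin Q? ≡ ∑[ i < n ] 𝟙 (Q? i)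
#Fin-as-sum Q? = length-filter-tabulate Q? (λ i → i)

tailSum-as-sum : (c : Fin n) (r : Fin n → ℕ) → tailSum c r ≡ ∑[ i < n ] (𝟙 (c Fin.≤? i) * r i)
tailSum-as-sum c r = sum-filter-tabulate (c Fin.≤?_) r (λ i → i)

tailSum-zero : (r : Fin (suc n) → ℕ) → tailSum zero r ≡ sum r
tailSum-zero {n} r = trans (tailSum-as-sum zero r)
  (sum-cong-≗ λ i → trans (cong (_* r i) (𝟙-true (zero {n} Fin.≤? i) z≤n)) (*-identityˡ (r i)))

tailSum-suc : (c : Fin n) (r : Fin (suc n) → ℕ) → tailSum (suc c) r ≡ tailSum c (r ∘ suc)
tailSum-suc c r = trans (tailSum-as-sum (suc c) r) (trans
  (sum-cong-≗ λ i → cong (_* r (suc i))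
    (𝟙-cong (mk⇔ (λ { (s≤s p) → p }) s≤s) (suc c Fin.≤? suc i) (c Fin.≤? i)))
  (sym (tailSum-as-sum c (r ∘ suc))))

-- Abel summation.
tailSum-dominance : (r r′ g : Fin n → ℕ) →
  (∀ c → tailSum c r ≤ tailSum c r′) → (∀ {i j} → i ≤ᶠ j → g i ≤ g j) →
  ∑[ i < n ] (r i * g i) ≤ ∑[ i < n ] (r′ i * g i)
tailSum-dominance {zero}  r r′ g tails g-mono = z≤n
tailSum-dominance {suc n} r r′ g tails g-mono = begin
  sum (λ i → r i * g i)                                      ≡⟨ peel r ⟩
  sum r * g zero + sum (λ i → r (suc i) * (g (suc i) ∸ g zero))
    ≤⟨ +-mono-≤ (*-monoˡ-≤ (g zero) (subst₂ _≤_ (tailSum-zero r) (tailSum-zero r′) (tails zero)))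
                (tailSum-dominance (r ∘ suc) (r′ ∘ suc) (λ i → g (suc i) ∸ g zero)
                  (λ c → subst₂ _≤_ (tailSum-suc c r) (tailSum-suc c r′) (tails (suc c)))
                  (λ i≤j → ∸-monoˡ-≤ (g zero) (g-mono (s≤s i≤j)))) ⟩
  sum r′ * g zero + sum (λ i → r′ (suc i) * (g (suc i) ∸ g zero)) ≡⟨ peel r′ ⟨
  sum (λ i → r′ i * g i)                                     ∎
  where
  open ≤-Reasoning
  -- Takes the value `g zero` out of every term. It is the minimum of `g`, so the truncated
  -- subtraction is exact, and the remaining differences are again nondecreasing.
  peel : ∀ s → sum (λ i → s i * g i) ≡ sum s * g zero + sum (λ i → s (suc i) * (g (suc i) ∸ g zero))
  peel s = ≡.begin
    s zero * g zero + sum (λ i → s (suc i) * g (suc i))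
      ≡.≡⟨ cong (s zero * g zero +_) (sum-cong-≗ λ i → trans
          (cong (s (suc i) *_) (sym (m+[n∸m]≡n (g-mono {zero} {suc i} z≤n))))
          (*-distribˡ-+ (s (suc i)) (g zero) _)) ⟩
    s zero * g zero + sum (λ i → s (suc i) * g zero + s (suc i) * (g (suc i) ∸ g zero))
      ≡.≡⟨ cong (s zero * g zero +_) (trans (∑-distrib-+ (λ i → s (suc i) * g zero) _)
            (cong (_+ rest) (sym (*-distribʳ-sum (g zero) (s ∘ suc))))) ⟩
    s zero * g zero + (sum (s ∘ suc) * g zero + rest)
      ≡.≡⟨ +-assoc (s zero * g zero) _ rest ⟨
    s zero * g zero + sum (s ∘ suc) * g zero + rest
      ≡.≡⟨ cong (_+ rest) (*-distribʳ-+ (g zero) (s zero) _) ⟨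
    sum s * g zero + rest ≡.∎
    where
    module ≡ = ≡-Reasoning
    rest = sum (λ i → s (suc i) * (g (suc i) ∸ g zero))

monotone-from-steps : (F : Fin n → ℕ) → (∀ i i⁺ → toℕ i⁺ ≡ suc (toℕ i) → F i ≤ F i⁺) →
                      ∀ {i j} → i ≤ᶠ j → F i ≤ F j
monotone-from-steps {suc zero} F step {zero} {zero} i≤j = ≤-refl
monotone-from-steps {suc (suc n)} F step {zero} {zero} i≤j = ≤-refl
monotone-from-steps {suc (suc n)} F step {zero} {suc j} i≤j = ≤-trans (step zero (suc zero) refl)
  (monotone-from-steps (F ∘ suc) (λ i i⁺ e → step (suc i) (suc i⁺) (cong suc e)) {zero} {j} z≤n)
monotone-from-steps {suc (suc n)} F step {suc i} {suc j} (s≤s i≤j) =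
  monotone-from-steps (F ∘ suc) (λ i i⁺ e → step (suc i) (suc i⁺) (cong suc e)) {i} {j} i≤j

-- Sums over all maps Fin n → Fin h

-- Enumerates maps value by value, which suits summing out one vertex at a time; `sum-finToFun`
-- links this to the numeric codes behind `hom`.
sumMaps : ∀ n {h} → ((Fin n → Fin h) → ℕ) → ℕ
sumMaps zero        F = F []
sumMaps (suc n) {h} F = ∑[ x < h ] sumMaps n (λ f → F (x ∷ f))

-- Maps built by `∷`, `insertAt` and `finToFun` agree only pointwise, so exchanging them inside `F`
-- relies on this.
Extensional : ((Fin n → Fin h) → ℕ) → Set
Extensional F = ∀ {f g} → f ≗ g → F f ≡ F g

∷-cong : {x : Fin h} {f g : Fin n → Fin h} → f ≗ g → (x ∷ f) ≗ (x ∷ g)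
∷-cong f≗g zero    = refl
∷-cong f≗g (suc i) = f≗g i

insertAt-cong : {f g : Fin n → Fin h} (i : Fin (suc n)) {x : Fin h} → f ≗ g →
                insertAt f i x ≗ insertAt g i x
insertAt-cong {n}     zero    f≗g zero    = refl
insertAt-cong {n}     zero    f≗g (suc j) = f≗g j
insertAt-cong {suc n} (suc i) f≗g zero    = f≗g zero
insertAt-cong {suc n} (suc i) f≗g (suc j) = insertAt-cong i (f≗g ∘ suc) j

sumMaps-cong : ∀ n {F G : (Fin n → Fin h) → ℕ} → (∀ f → F f ≡ G f) → sumMaps n F ≡ sumMaps n G
sumMaps-cong zero    F≗G = F≗G []
sumMaps-cong (suc n) F≗G = sum-cong-≗ λ x → sumMaps-cong n λ f → F≗G (x ∷ f)

sumMaps-comm-sum : ∀ n (F : Fin m → (Fin n → Fin h) → ℕ) →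
  ∑[ y < m ] sumMaps n (F y) ≡ sumMaps n λ f → ∑[ y < m ] F y f
sumMaps-comm-sum zero    F = refl
sumMaps-comm-sum (suc n) F =
  trans (∑-comm λ y x → sumMaps n λ f → F y (x ∷ f))
        (sum-cong-≗ λ x → sumMaps-comm-sum n λ y f → F y (x ∷ f))

insertAt-zero : (f : Fin n → Fin h) (x : Fin h) → (x ∷ f) ≗ insertAt f zero x
insertAt-zero f x zero    = refl
insertAt-zero f x (suc j) = refl

insertAt-suc : (i : Fin (suc n)) (f : Fin n → Fin h) (x y : Fin h) →
               (y ∷ insertAt f i x) ≗ insertAt (y ∷ f) (suc i) x
insertAt-suc i f x y zero    = refl
insertAt-suc i f x y (suc j) = refl

-- The sum over coordinate `i` is exchanged with those before it. An arbitrary `i` is wanted because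
-- a leaf may sit at any index.
sumMaps-insertAt : ∀ {n h} (i : Fin (suc n)) (F : (Fin (suc n) → Fin h) → ℕ) → Extensional F →
  sumMaps (suc n) F ≡ ∑[ x < h ] sumMaps n λ f → F (insertAt f i x)
sumMaps-insertAt {n} {h} zero F ext = sum-cong-≗ {h} λ x → sumMaps-cong n λ f →
  ext (insertAt-zero f x)
sumMaps-insertAt {suc n} {h} (suc i) F ext = trans
  (sum-cong-≗ {h} λ y → sumMaps-insertAt i (λ f → F (y ∷ f)) (ext ∘ ∷-cong))
  (trans (∑-comm λ y x → sumMaps n λ f → F (y ∷ insertAt f i x))
         (sum-cong-≗ {h} λ x → sum-cong-≗ {h} λ y → sumMaps-cong n λ f →
           ext (insertAt-suc i f x y)))

sum-finToFun : ∀ n {h} (F : (Fin n → Fin h) → ℕ) → Extensional F →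
  sum {h ^ n} (λ c → F (finToFun c)) ≡ sumMaps n F
sum-finToFun zero    F ext = trans (+-identityʳ _) (ext λ ())
sum-finToFun (suc n) {h} F ext = trans (sum-combine h _) (sum-cong-≗ λ x → trans
  -- `combine x c` encodes `x ∷ finToFun c`: `remQuot` returns the value at `zero` and the code of
  -- the rest.
  (sum-cong-≗ λ c → ext λ
    { zero    → cong proj₁ (Fin.remQuot-combine {h} x c)
    ; (suc i) → cong (λ q → finToFun (proj₂ q) i) (Fin.remQuot-combine {h} x c) })
  (sum-finToFun n (λ f → F (x ∷ f)) (ext ∘ ∷-cong)))

-- The rearrangement inequality for two pairs

rearrangement : ∀ {a b c d} → a ≤ b → c ≤ d → a * d + b * c ≤ a * c + b * d
rearrangement {a} {c = c} a≤b c≤d with e , refl ← m≤n⇒∃[o]m+o≡n a≤b | f , refl ← m≤n⇒∃[o]m+o≡n c≤d =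
  -- With `b = a + e` and `d = c + f` the two sides differ by `e * f`.
  ≤-trans (m≤m+n _ (e * f)) (≤-reflexive
    (solve 4 (λ a c e f → a :* (c :+ f) :+ (a :+ e) :* c :+ e :* f := a :* c :+ (a :+ e) :* (c :+ f))
       refl a c e f))
  where open +-*-Solver

rearrangement-< : ∀ {a b c d} → a < b → c < d → a * d + b * c < a * c + b * d
rearrangement-< {a} {c = c} a<b c<d with e , refl ← m≤n⇒∃[o]m+o≡n a<b | f , refl ← m≤n⇒∃[o]m+o≡n c<d =
  -- Now `b = 1 + a + e` and `d = 1 + c + f`, and the difference is `(1 + e) * (1 + f)`.
  ≤-trans (s≤s (m≤m+n _ (e + f + e * f))) (≤-reflexive
    (solve 4 (λ a c e f → con 1 :+ (a :* (con 1 :+ c :+ f) :+ (con 1 :+ a :+ e) :* c :+ (e :+ f :+ e :* f))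
                       := a :* c :+ (con 1 :+ a :+ e) :* (con 1 :+ c :+ f))
       refl a c e f))
  where open +-*-Solver

-- Walks in the target graph

module Walks {h} (H : Graph h) where
  open Graph H

  Weight : Set
  Weight = Fin h → ℕ

  infix 8 ⟨_,_⟩
  ⟨_,_⟩ : Weight → Weight → ℕ
  ⟨ f , g ⟩ = ∑[ x < h ] (f x * g x)

  infixl 9 _⊙_
  _⊙_ : Weight → Weight → Weight
  (f ⊙ g) x = f x * g x

  one : Weight
  one _ = 1

  ⟨⟩-comm : ∀ f g → ⟨ f , g ⟩ ≡ ⟨ g , f ⟩
  ⟨⟩-comm f g = sum-cong-≗ λ x → *-comm (f x) (g x)

  ⟨⟩-⊙ : ∀ f g k → ⟨ f , g ⊙ k ⟩ ≡ ⟨ f ⊙ k , g ⟩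
  ⟨⟩-⊙ f g k = sum-cong-≗ λ x → trans (cong (f x *_) (*-comm (g x) (k x))) (sym (*-assoc (f x) (k x) (g x)))

  ⟨⟩-assoc : ∀ f g k → ⟨ f , g ⊙ k ⟩ ≡ ⟨ f ⊙ g , k ⟩
  ⟨⟩-assoc f g k = sum-cong-≗ λ x → sym (*-assoc (f x) (g x) (k x))

  -- The adjacency operator `A`. Then `walk m` is `A^m`, and `paths m` is `A^m 1`.
  step : Weight → Weight
  step g x = ∑[ y < h ] (𝟙 (adj? x y) * g y)

  walk : ℕ → Weight → Weight
  walk zero    g = g
  walk (suc m) g = step (walk m g)

  paths : ℕ → Weight
  paths m = walk m one

  -- The entries of `A^m`: the number of walks with `m` edges from `x` to `y`.
  kernel : ℕ → Fin h → Fin h → ℕ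
  kernel zero    x y = 𝟙 (y ≟ x)
  kernel (suc m) x y = ∑[ z < h ] (𝟙 (adj? x z) * kernel m z y)

  walk-+ : ∀ m n g → walk m (walk n g) ≡ walk (m + n) g
  walk-+ zero    n g = refl
  walk-+ (suc m) n g = cong step (walk-+ m n g)

  walk-step : ∀ m g → walk m (step g) ≡ step (walk m g)
  walk-step m g = trans (walk-+ m 1 g) (cong (λ k → walk k g) (+-comm m 1))

  double-sum-factor : ∀ (f : Weight) (K : Fin h → Fin h → ℕ) (g : Weight) →
    ∑[ x < h ] (f x * ∑[ y < h ] (K x y * g y)) ≡ ∑[ x < h ] ∑[ y < h ] (K x y * (f x * g y))
  double-sum-factor f K g = sum-cong-≗ λ x → trans (*-distribˡ-sum (f x) (λ y → K x y * g y))
    (sum-cong-≗ λ y → x∙yz≈y∙xz (f x) (K x y) (g y))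
    where open import Algebra.Properties.CommutativeSemigroup *-commutativeSemigroup

  -- Both sides sum `f x * g y` over ordered adjacent pairs, and adjacency is symmetric. In the tree
  -- comparisons this moves an edge from a branch to the weight paired with it.
  step-self-adjoint : ∀ f g → ⟨ f , step g ⟩ ≡ ⟨ step f , g ⟩
  step-self-adjoint f g = begin
    ⟨ f , step g ⟩                                        ≡⟨ double-sum-factor f (λ x y → 𝟙 (adj? x y)) g ⟩
    ∑[ x < h ] ∑[ y < h ] (𝟙 (adj? x y) * (f x * g y))    ≡⟨ ∑-comm (λ x y → 𝟙 (adj? x y) * (f x * g y)) ⟩
    ∑[ y < h ] ∑[ x < h ] (𝟙 (adj? x y) * (f x * g y))
      ≡⟨ (sum-cong-≗ λ y → sum-cong-≗ λ x → cong₂ _*_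
           (𝟙-cong (mk⇔ adj-sym adj-sym) (adj? x y) (adj? y x)) (*-comm (f x) (g y))) ⟩
    ∑[ y < h ] ∑[ x < h ] (𝟙 (adj? y x) * (g y * f x))    ≡⟨ double-sum-factor g (λ x y → 𝟙 (adj? x y)) f ⟨
    ⟨ g , step f ⟩                                        ≡⟨ ⟨⟩-comm g (step f) ⟩
    ⟨ step f , g ⟩                                        ∎
    where open ≡-Reasoning

  walk-self-adjoint : ∀ m f g → ⟨ f , walk m g ⟩ ≡ ⟨ walk m f , g ⟩
  walk-self-adjoint zero    f g = refl
  walk-self-adjoint (suc m) f g = begin
    ⟨ f , step (walk m g) ⟩ ≡⟨ step-self-adjoint f (walk m g) ⟩
    ⟨ step f , walk m g ⟩   ≡⟨ walk-self-adjoint m (step f) g ⟩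
    ⟨ walk m (step f) , g ⟩ ≡⟨ cong (λ k → ⟨ k , g ⟩) (walk-step m f) ⟩
    ⟨ step (walk m f) , g ⟩ ∎
    where open ≡-Reasoning

  walk-kernel : ∀ m g x → walk m g x ≡ ∑[ y < h ] (kernel m x y * g y)
  walk-kernel zero    g x = sym (sum-𝟙-≟ x g)
  walk-kernel (suc m) g x = begin
    ∑[ z < h ] (a z * walk m g z)                               ≡⟨ (sum-cong-≗ λ z → cong (a z *_) (walk-kernel m g z)) ⟩
    ∑[ z < h ] (a z * ∑[ y < h ] (kernel m z y * g y))
      ≡⟨ (sum-cong-≗ λ z → trans (*-distribˡ-sum (a z) (λ y → kernel m z y * g y))
           (sum-cong-≗ λ y → sym (*-assoc (a z) (kernel m z y) (g y)))) ⟩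
    ∑[ z < h ] ∑[ y < h ] (a z * kernel m z y * g y)            ≡⟨ ∑-comm (λ z y → a z * kernel m z y * g y) ⟩
    ∑[ y < h ] ∑[ z < h ] (a z * kernel m z y * g y)
      ≡⟨ (sum-cong-≗ λ y → sym (*-distribʳ-sum (g y) (λ z → a z * kernel m z y))) ⟩
    ∑[ y < h ] (kernel (suc m) x y * g y)                       ∎
    where
    open ≡-Reasoning
    a = λ z → 𝟙 (adj? x z)

  -- `f` traces a walk with `m` edges; the sum in the kernel is at least its term at the second
  -- vertex of that walk.
  kernel-positive : ∀ m (f : Fin (suc m) → Fin h) →
    (∀ i j → toℕ j ≡ suc (toℕ i) → Adj (f i) (f j)) → 1 ≤ kernel m (f zero) (f (fromℕ m))
  kernel-positive zero    f adj = ≤-reflexive (sym (𝟙-true (f zero ≟ f zero) refl))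
  kernel-positive (suc m) f adj = begin
    1
      ≤⟨ kernel-positive m (f ∘ suc) (λ i j e → adj (suc i) (suc j) (cong suc e)) ⟩
    kernel m x₁ y
      ≡⟨ trans (cong (_* kernel m x₁ y) (𝟙-true (adj? x₀ x₁) (adj zero (suc zero) refl))) (+-identityʳ _) ⟨
    𝟙 (adj? x₀ x₁) * kernel m x₁ y
      ≤⟨ term≤sum (λ z → 𝟙 (adj? x₀ z) * kernel m z y) x₁ ⟩
    kernel (suc m) x₀ y ∎
    where
    open ≤-Reasoning
    x₀ = f zero
    x₁ = f (suc zero)
    y = f (fromℕ (suc m))

  private
    form : ℕ → Weight → Weight → ℕ
    form m f g = ∑[ x < h ] ∑[ y < h ] (kernel m x y * (f x * g y))

    form-walk : ∀ m f g → form m f g ≡ ⟨ f , walk m g ⟩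
    form-walk m f g = trans (sym (double-sum-factor f (kernel m) g))
      (sum-cong-≗ λ x → cong (f x *_) (sym (walk-kernel m g x)))

    double : ℕ → ℕ
    double x = x + x

    double-cancel-≤ : ∀ {x y} → double x ≤ double y → x ≤ y
    double-cancel-≤ {x} {y} le with x ≤? y
    ... | yes x≤y = x≤y
    ... | no  x≰y = contradiction le (<⇒≱ (+-mono-< (≰⇒> x≰y) (≰⇒> x≰y)))

    double-cancel-< : ∀ {x y} → double x < double y → x < y
    double-cancel-< {x} {y} lt with suc x ≤? y
    ... | yes x<y = x<y
    ... | no  x≮y = contradiction lt (≤⇒≯ (+-mono-≤ (≮⇒≥ x≮y) (≮⇒≥ x≮y)))

    -- `aligned` minus `crossed` is `kernel m x y * (f x − f y) * (g x − g y)`. Comparing the two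
    -- avoids subtraction, and comparing doubled sums avoids the factor one half.
    crossed aligned : ℕ → Weight → Weight → Fin h → Fin h → ℕ
    crossed m f g x y = kernel m x y * (f x * g y + g x * f y)
    aligned m f g x y = kernel m x y * (f x * g x + f y * g y)

    -- The two products in `crossed` give the bilinear form at `f`, `g` and at `g`, `f`; these agree
    -- because `walk m` is self-adjoint.
    crossed-sum : ∀ m f g → ∑[ x < h ] ∑[ y < h ] crossed m f g x y ≡ double ⟨ f , walk m g ⟩
    crossed-sum m f g = begin
      ∑[ x < h ] ∑[ y < h ] crossed m f g x y
        ≡⟨ (sum-cong-≗ λ x → trans (sum-cong-≗ λ y → *-distribˡ-+ (kernel m x y) (f x * g y) (g x * f y))
                                   (∑-distrib-+ (λ y → kernel m x y * (f x * g y)) _)) ⟩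
      ∑[ x < h ] (∑[ y < h ] (kernel m x y * (f x * g y)) + ∑[ y < h ] (kernel m x y * (g x * f y)))
        ≡⟨ ∑-distrib-+ (λ x → ∑[ y < h ] (kernel m x y * (f x * g y))) _ ⟩
      form m f g + form m g f              ≡⟨ cong₂ _+_ (form-walk m f g) (form-walk m g f) ⟩
      ⟨ f , walk m g ⟩ + ⟨ g , walk m f ⟩
        ≡⟨ cong (⟨ f , walk m g ⟩ +_) (trans (walk-self-adjoint m g f) (⟨⟩-comm (walk m g) f)) ⟩
      double ⟨ f , walk m g ⟩              ∎
      where open ≡-Reasoning

    -- `aligned` for `f` and `g` is `crossed` for `f ⊙ g` and `one`, so `crossed-sum` applies again.
    aligned-sum : ∀ m f g → ∑[ x < h ] ∑[ y < h ] aligned m f g x y ≡ double ⟨ f ⊙ g , paths m ⟩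
    aligned-sum m f g = begin
      ∑[ x < h ] ∑[ y < h ] aligned m f g x y
        ≡⟨ (sum-cong-≗ λ x → sum-cong-≗ λ y → cong (kernel m x y *_)
             (cong₂ _+_ (sym (*-identityʳ (f x * g x))) (sym (*-identityˡ (f y * g y))))) ⟩
      ∑[ x < h ] ∑[ y < h ] (kernel m x y * ((f ⊙ g) x * one y + one x * (f ⊙ g) y))
        ≡⟨ crossed-sum m (f ⊙ g) one ⟩
      double ⟨ f ⊙ g , paths m ⟩ ∎
      where open ≡-Reasoning

  -- The inequality `(f x − f y) * (g x − g y) ≥ 0` without subtraction.
  Comonotone : Weight → Weight → Set
  Comonotone f g = ∀ x y → f x * g y + g x * f y ≤ f x * g x + f y * g y

  -- The slide: on the left `f` and `g` sit at opposite ends of a path with `m` edges, on the right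
  -- both sit at the same end. After doubling, the comparison holds term by term.
  walk-comonotone-≤ : ∀ m f g → Comonotone f g → ⟨ f , walk m g ⟩ ≤ ⟨ f ⊙ g , paths m ⟩
  walk-comonotone-≤ m f g com = double-cancel-≤ (subst₂ _≤_ (crossed-sum m f g) (aligned-sum m f g)
    (sum-mono-≤ λ x → sum-mono-≤ λ y → *-monoʳ-≤ (kernel m x y) (com x y)))

  -- A single pair joined by a walk with `m` edges and strictly separated by both weights makes one
  -- term strict.
  walk-comonotone-< : ∀ m f g → Comonotone f g → ∀ x y → 1 ≤ kernel m x y → f x < f y → g x < g y →
    ⟨ f , walk m g ⟩ < ⟨ f ⊙ g , paths m ⟩
  walk-comonotone-< m f g com x y positive fx<fy gx<gy = double-cancel-<
    (subst₂ _<_ (crossed-sum m f g) (aligned-sum m f g)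
      (sum-mono-< (λ x → sum-mono-≤ (term x)) x (sum-mono-< (term x) y strict)))
    where
    term : ∀ x y → crossed m f g x y ≤ aligned m f g x y
    term x y = *-monoʳ-≤ (kernel m x y) (com x y)
    strict : crossed m f g x y < aligned m f g x y
    strict = *-monoʳ-< (kernel m x y) {{>-nonZero positive}} (subst (_< f x * g x + f y * g y)
      (cong (f x * g y +_) (*-comm (f y) (g x))) (rearrangement-< fx<fy gx<gy))

-- Rooted trees

data RootedTree : Set where
  point : RootedTree
  -- graft s t joins the root of t to the root of s by a new edge and keeps
  -- the root of t.
  graft : RootedTree → RootedTree → RootedTree

edges : RootedTree → ℕ
edges point       = 0
edges (graft s t) = suc (edges s) + edges t

rootDegree : RootedTree → ℕ
rootDegree point       = 0
rootDegree (graft s t) = suc (rootDegree t)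

-- Bookkeeping for deleting a leaf `ℓ` with neighbour `p`: what hangs at `ℓ` must not be lost, so it
-- is hung, with the edge, at `p`.
graftLeaf : (Fin (suc n) → RootedTree) → Fin (suc n) → Fin n → Fin n → RootedTree
graftLeaf w ℓ p v = if does (v ≟ p) then graft (w ℓ) (w (punchIn ℓ v)) else w (punchIn ℓ v)

graftLeaf-edges : (w : Fin (suc n) → RootedTree) (ℓ : Fin (suc n)) (p : Fin n) →
  sum (edges ∘ graftLeaf w ℓ p) ≡ suc (sum (edges ∘ w))
graftLeaf-edges {n} w ℓ p = begin
  sum (edges ∘ graftLeaf w ℓ p)
    ≡⟨ (sum-cong-≗ λ v → split (does (v ≟ p)) (w ℓ) (w (punchIn ℓ v))) ⟩
  sum {n} (λ v → (if does (v ≟ p) then suc (edges (w ℓ)) else 0) + edges (w (punchIn ℓ v)))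
    ≡⟨ ∑-distrib-+ (λ v → if does (v ≟ p) then suc (edges (w ℓ)) else 0) (λ v → edges (w (punchIn ℓ v))) ⟩
  sum {n} (λ v → if does (v ≟ p) then suc (edges (w ℓ)) else 0) + sum (λ v → edges (w (punchIn ℓ v)))
    ≡⟨ cong (_+ sum (λ v → edges (w (punchIn ℓ v))))
         (sum-single +-0-commutativeMonoid p (λ _ → suc (edges (w ℓ)))) ⟩
  suc (edges (w ℓ) + sum (λ v → edges (w (punchIn ℓ v))))
    ≡⟨ cong suc (sum-remove {i = ℓ} (edges ∘ w)) ⟨
  suc (sum (edges ∘ w)) ∎
  where
  open ≡-Reasoning
  split : ∀ b s t → edges (if b then graft s t else t) ≡ (if b then suc (edges s) else 0) + edges t
  split true  s t = refl
  split false s t = refl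

graftLeaf-rootDegree : (w : Fin (suc n) → RootedTree) (ℓ : Fin (suc n)) (p v : Fin n) →
  rootDegree (graftLeaf w ℓ p v) ≡ rootDegree (w (punchIn ℓ v)) + 𝟙 (v ≟ p)
graftLeaf-rootDegree w ℓ p v with does (v ≟ p)
... | true  = +-comm 1 _
... | false = sym (+-identityʳ _)

module RootedColorings {h} (H : Graph h) where
  open Walks H public

  -- colorings t x counts the colorings of t with the root mapped to x.
  colorings : RootedTree → Weight
  colorings point       = one
  colorings (graft s t) = step (colorings s) ⊙ colorings t

-- Monotone weights and the straightening of rooted trees

module MonotoneColorings {h} (H : Graph h) (O : ClassOrdering H)
  (increasing : IncreasingColumns (ClassOrdering.similarityMatrix O)) where
  open Graph H
  open RootedColorings H
  open ClassOrdering O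

  -- Includes being constant on each class, since vertices of one class compare both ways.
  Monotone : Weight → Set
  Monotone g = ∀ {x y} → class x ≤ᶠ class y → g x ≤ g y

  monotone-class : ∀ {g x y} → Monotone g → class x ≡ class y → g x ≡ g y
  monotone-class mono eq =
    ≤-antisym (mono (≤-reflexive (cong toℕ eq))) (mono (≤-reflexive (cong toℕ (sym eq))))

  monotone-rep : ∀ {g} → Monotone g → ∀ x → g x ≡ g (rep (class x))
  monotone-rep {g} mono x = monotone-class {g} mono (sym (proj₂ (nonempty (class x))))

  monotone-comonotone : ∀ {f g} → Monotone f → Monotone g → Comonotone f g
  monotone-comonotone {f} {g} mono-f mono-g x y with ≤-total (toℕ (class x)) (toℕ (class y))
  ... | inj₁ x≤y = subst (_≤ f x * g x + f y * g y) (cong (f x * g y +_) (*-comm (f y) (g x)))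
                     (rearrangement (mono-f x≤y) (mono-g x≤y))
  ... | inj₂ y≤x = subst₂ _≤_
                     (trans (+-comm (f y * g x) (f x * g y)) (cong (f x * g y +_) (*-comm (f y) (g x))))
                     (+-comm (f y * g y) (f x * g x))
                     (rearrangement (mono-f y≤x) (mono-g y≤x))

  one-monotone : Monotone one
  one-monotone _ = ≤-refl

  ⊙-monotone : ∀ {f g} → Monotone f → Monotone g → Monotone (f ⊙ g)
  ⊙-monotone mono-f mono-g x≤y = *-mono-≤ (mono-f x≤y) (mono-g x≤y)

  -- An automorphism taking `x` to `y` permutes the summands: it preserves adjacency, and it
  -- preserves `g` because it preserves classes.
  step-class : ∀ {g} → Monotone g → ∀ {x y} → class x ≡ class y → step g x ≡ step g y
  step-class {g} mono {x} {y} eq with π , iso , refl ← from (class-spec x y) eq = begin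
    ∑[ z < h ] (𝟙 (adj? x z) * g z)
      ≡⟨ (sum-cong-≗ λ z → cong₂ _*_ (𝟙-cong (iso x z) (adj? x z) (adj? (π ⟨$⟩ʳ x) (π ⟨$⟩ʳ z)))
           (monotone-class {g} mono (to (class-spec z (π ⟨$⟩ʳ z)) (π , iso , refl)))) ⟩
    ∑[ z < h ] (𝟙 (adj? (π ⟨$⟩ʳ x) (π ⟨$⟩ʳ z)) * g (π ⟨$⟩ʳ z))
      ≡⟨ ∑-permute (λ z → 𝟙 (adj? (π ⟨$⟩ʳ x) z) * g z) π ⟨
    ∑[ z < h ] (𝟙 (adj? (π ⟨$⟩ʳ x) z) * g z) ∎
    where open ≡-Reasoning

  -- Grouping the neighbours of `rep i` by class turns `A` into the similarity matrix acting on
  -- values at representatives.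
  step-matrix : ∀ {g} → Monotone g → ∀ i → step g (rep i) ≡ ∑[ j < k ] (similarityMatrix i j * g (rep j))
  step-matrix {g} mono i = begin
    ∑[ w < h ] (a w * g w)
      ≡⟨ (sum-cong-≗ λ w → cong (a w *_) (trans (monotone-rep {g} mono w) (by-class w))) ⟩
    ∑[ w < h ] (a w * ∑[ j < k ] (c w j * g (rep j)))
      ≡⟨ (sum-cong-≗ λ w → trans (*-distribˡ-sum (a w) (λ j → c w j * g (rep j)))
           (sum-cong-≗ λ j → sym (*-assoc (a w) (c w j) (g (rep j))))) ⟩
    ∑[ w < h ] ∑[ j < k ] (a w * c w j * g (rep j))
      ≡⟨ ∑-comm (λ w j → a w * c w j * g (rep j)) ⟩
    ∑[ j < k ] ∑[ w < h ] (a w * c w j * g (rep j))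
      ≡⟨ (sum-cong-≗ λ j → trans (sym (*-distribʳ-sum (g (rep j)) (λ w → a w * c w j)))
           (cong (_* g (rep j)) (sym (entry j)))) ⟩
    ∑[ j < k ] (similarityMatrix i j * g (rep j)) ∎
    where
    open ≡-Reasoning
    a : Fin h → ℕ
    a w = 𝟙 (adj? (rep i) w)
    c : Fin h → Fin k → ℕ
    c w j = 𝟙 (class w ≟ j)
    by-class : ∀ w → g (rep (class w)) ≡ ∑[ j < k ] (c w j * g (rep j))
    by-class w = trans (sym (sum-𝟙-≟ (class w) (g ∘ rep)))
      (sum-cong-≗ λ j → cong (_* g (rep j)) (𝟙-cong (mk⇔ sym sym) (j ≟ class w) (class w ≟ j)))
    entry : ∀ j → similarityMatrix i j ≡ ∑[ w < h ] (a w * c w j)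
    entry j = trans (#Fin-as-sum (λ w → adj? (rep i) w ×-dec (class w ≟ j)))
      (sum-cong-≗ λ w → 𝟙-× (adj? (rep i) w) (class w ≟ j))

  -- Increasing columns enter here: the tail sums of consecutive matrix rows are ordered, and Abel
  -- summation carries this over to sums against the nondecreasing `g ∘ rep`.
  step-monotone : ∀ {g} → Monotone g → Monotone (step g)
  step-monotone {g} mono {x} {y} x≤y = subst₂ _≤_ (sym (at-rep x)) (sym (at-rep y))
    (monotone-from-steps (step g ∘ rep) next x≤y)
    where
    at-rep : ∀ x → step g x ≡ step g (rep (class x))
    at-rep x = step-class {g} mono (sym (proj₂ (nonempty (class x))))
    next : ∀ i i⁺ → toℕ i⁺ ≡ suc (toℕ i) → step g (rep i) ≤ step g (rep i⁺)
    next i i⁺ e = subst₂ _≤_ (sym (step-matrix {g} mono i)) (sym (step-matrix {g} mono i⁺))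
      (tailSum-dominance (similarityMatrix i) (similarityMatrix i⁺) (g ∘ rep)
        (λ c → increasing c i i⁺ e)
        (λ {i} {j} i≤j → mono (subst₂ _≤ᶠ_ (sym (proj₂ (nonempty i))) (sym (proj₂ (nonempty j))) i≤j)))

  paths-monotone : ∀ m → Monotone (paths m)
  paths-monotone zero    = one-monotone
  paths-monotone (suc m) = step-monotone (paths-monotone m)

  colorings-monotone : ∀ t → Monotone (colorings t)
  colorings-monotone point       = one-monotone
  colorings-monotone (graft s t) = ⊙-monotone {step (colorings s)} {colorings t}
    (step-monotone (colorings-monotone s)) (colorings-monotone t)

  -- Straightens both branches of a graft, without yet joining the two paths.
  graft-≥-two-paths : ∀ s t {g} → Monotone g →
    (∀ {g} → Monotone g → ⟨ g , paths (edges s) ⟩ ≤ ⟨ g , colorings s ⟩) →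
    (∀ {g} → Monotone g → ⟨ g , paths (edges t) ⟩ ≤ ⟨ g , colorings t ⟩) →
    ⟨ g ⊙ paths (edges t) , paths (suc (edges s)) ⟩ ≤ ⟨ g , colorings (graft s t) ⟩
  graft-≥-two-paths s t {g} mono s-≥ t-≥ = begin
    ⟨ g ⊙ paths e , paths (suc d) ⟩           ≡⟨ ⟨⟩-⊙ g (paths (suc d)) (paths e) ⟨
    ⟨ g , paths (suc d) ⊙ paths e ⟩           ≡⟨ ⟨⟩-assoc g (paths (suc d)) (paths e) ⟩
    -- `t` is straightened against all that hangs at its root: `g` and the path that stands for `s`.
    ⟨ g ⊙ paths (suc d) , paths e ⟩           ≤⟨ t-≥ (⊙-monotone {g} {paths (suc d)} mono (paths-monotone (suc d))) ⟩
    ⟨ g ⊙ paths (suc d) , colorings t ⟩       ≡⟨ ⟨⟩-assoc g (paths (suc d)) (colorings t) ⟨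
    ⟨ g , paths (suc d) ⊙ colorings t ⟩       ≡⟨ ⟨⟩-⊙ g (paths (suc d)) (colorings t) ⟩
    -- The joining edge passes to the other side, so that `s` is paired with a monotone weight at
    -- its own root.
    ⟨ g ⊙ colorings t , step (paths d) ⟩      ≡⟨ step-self-adjoint (g ⊙ colorings t) (paths d) ⟩
    ⟨ step (g ⊙ colorings t) , paths d ⟩
      ≤⟨ s-≥ (step-monotone (⊙-monotone {g} {colorings t} mono (colorings-monotone t))) ⟩
    ⟨ step (g ⊙ colorings t) , colorings s ⟩  ≡⟨ step-self-adjoint (g ⊙ colorings t) (colorings s) ⟨
    ⟨ g ⊙ colorings t , step (colorings s) ⟩  ≡⟨ ⟨⟩-⊙ g (step (colorings s)) (colorings t) ⟨
    ⟨ g , step (colorings s) ⊙ colorings t ⟩  ∎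
    where
    open ≤-Reasoning
    d = edges s
    e = edges t

  -- Induction on the tree: straighten both branches, then slide one path to the far end of the
  -- other. The arbitrary monotone `g` stands for the rest of the tree, which is what lets the
  -- induction reach inside a branch.
  colorings-≥-paths : ∀ t {g} → Monotone g → ⟨ g , paths (edges t) ⟩ ≤ ⟨ g , colorings t ⟩
  colorings-≥-paths point       mono = ≤-refl
  colorings-≥-paths (graft s t) {g} mono = begin
    ⟨ g , paths (suc (edges s) + edges t) ⟩
      ≡⟨ cong (λ p → ⟨ g , p ⟩) (walk-+ (suc (edges s)) (edges t) one) ⟨
    ⟨ g , walk (suc (edges s)) (paths (edges t)) ⟩
      ≤⟨ walk-comonotone-≤ (suc (edges s)) g (paths (edges t))
           (monotone-comonotone {g} {paths (edges t)} mono (paths-monotone (edges t))) ⟩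
    ⟨ g ⊙ paths (edges t) , paths (suc (edges s)) ⟩
      ≤⟨ graft-≥-two-paths s t mono (colorings-≥-paths s) (colorings-≥-paths t) ⟩
    ⟨ g , colorings (graft s t) ⟩ ∎
    where open ≤-Reasoning

  -- Straightening `q`, `r` and `t` leaves paths with `a + 1`, `b + 1` and `c` edges at a common
  -- end. Sliding the one with `c` edges along the one with `b + 1` edges yields the single path.
  -- Root degree three ensures that `c` is positive.
  colorings->-paths :
    (∀ m → ∃[ x ] ∃[ y ] 1 ≤ kernel (suc m) x y × (∀ l → paths (suc l) x < paths (suc l) y)) →
    ∀ t → 3 ≤ rootDegree t → ⟨ one , paths (edges t) ⟩ < ⟨ one , colorings t ⟩
  colorings->-paths separated (graft q (graft r t@(graft t₁ t₂))) _ = begin-strict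
    ⟨ one , paths (suc a + (suc b + c)) ⟩
      ≡⟨ cong (λ p → ⟨ one , p ⟩) (walk-+ (suc a) (suc b + c) one) ⟨
    ⟨ one , walk (suc a) (paths (suc b + c)) ⟩
      ≡⟨ walk-self-adjoint (suc a) one (paths (suc b + c)) ⟩
    ⟨ paths (suc a) , paths (suc b + c) ⟩
      ≡⟨ cong (λ p → ⟨ paths (suc a) , p ⟩) (walk-+ (suc b) c one) ⟨
    ⟨ paths (suc a) , walk (suc b) (paths c) ⟩
      -- The pair for `b` is joined by a walk with `b + 1` edges. It separates path counts of every
      -- positive length, hence both `a + 1` and `c = suc (edges t₁ + edges t₂)`.
      <⟨ walk-comonotone-< (suc b) (paths (suc a)) (paths c)
           (monotone-comonotone {paths (suc a)} {paths c} (paths-monotone (suc a)) (paths-monotone c))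
           x y positive (gap a) (gap (edges t₁ + edges t₂)) ⟩
    ⟨ paths (suc a) ⊙ paths c , paths (suc b) ⟩
      ≤⟨ graft-≥-two-paths r t (paths-monotone (suc a)) (colorings-≥-paths r) (colorings-≥-paths t) ⟩
    ⟨ paths (suc a) , colorings u ⟩
      ≡⟨ ⟨⟩-comm (paths (suc a)) (colorings u) ⟩
    -- `q` is still a path here; moving its joining edge across allows it to be compared at its own
    -- root.
    ⟨ colorings u , step (paths a) ⟩
      ≡⟨ step-self-adjoint (colorings u) (paths a) ⟩
    ⟨ step (colorings u) , paths a ⟩
      ≤⟨ colorings-≥-paths q (step-monotone (colorings-monotone u)) ⟩
    ⟨ step (colorings u) , colorings q ⟩
      ≡⟨ step-self-adjoint (colorings u) (colorings q) ⟨
    ⟨ colorings u , step (colorings q) ⟩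
      ≡⟨ ⟨⟩-comm (colorings u) (step (colorings q)) ⟩
    ⟨ step (colorings q) , colorings u ⟩
      ≡⟨ sum-cong-≗ (λ x → sym (+-identityʳ (step (colorings q) x * colorings u x))) ⟩
    ⟨ one , step (colorings q) ⊙ colorings u ⟩ ∎
    where
    open ≤-Reasoning
    u = graft r t
    a = edges q
    b = edges r
    c = edges t
    x = proj₁ (separated b)
    y = proj₁ (proj₂ (separated b))
    positive = proj₁ (proj₂ (proj₂ (separated b)))
    gap = proj₂ (proj₂ (proj₂ (separated b)))
  colorings->-paths _ (graft _ point)           (s≤s ())
  colorings->-paths _ (graft _ (graft _ point)) (s≤s (s≤s ()))

-- Leaves of trees

data PunchView (i : Fin (suc n)) : Fin (suc n) → Set where
  same    : PunchView i i
  punched : ∀ j → PunchView i (punchIn i j)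

punchView : (i j : Fin (suc n)) → PunchView i j
punchView i j with i ≟ j
... | yes refl = same
... | no  i≢j  = subst (PunchView i) (punchIn-punchOut i≢j) (punched (punchOut i≢j))

deleteVertex : SimpleGraph (suc n) → Fin (suc n) → SimpleGraph n
deleteVertex T ℓ = record
  { graph = record
    { Adj     = λ u v → Adj (punchIn ℓ u) (punchIn ℓ v)
    ; adj?    = λ u v → adj? (punchIn ℓ u) (punchIn ℓ v)
    ; adj-sym = adj-sym
    }
  ; loopless = λ { refl → loopless refl }
  }
  where open SimpleGraph T

degree : SimpleGraph n → Fin n → ℕ
degree T u = sum λ v → 𝟙 (SimpleGraph.adj? T u v)

-- The neighbour `p` is named as a vertex of the graph without `ℓ`, where the inductions continue.
IsLeaf : SimpleGraph (suc n) → Fin (suc n) → Fin n → Set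
IsLeaf T ℓ p = ∀ v → SimpleGraph.Adj T ℓ (punchIn ℓ v) ⇔ v ≡ p

module _ (T : SimpleGraph (suc n)) {ℓ : Fin (suc n)} {p : Fin n} (leaf : IsLeaf T ℓ p) where
  open SimpleGraph T

  degree-deleteLeaf : ∀ u → degree T (punchIn ℓ u) ≡ 𝟙 (u ≟ p) + degree (deleteVertex T ℓ) u
  degree-deleteLeaf u = trans (sum-remove {i = ℓ} (λ v → 𝟙 (adj? (punchIn ℓ u) v)))
    (cong (_+ degree (deleteVertex T ℓ) u)
      (𝟙-cong (mk⇔ (λ a → to (leaf u) (adj-sym a)) (λ e → adj-sym (from (leaf u) e)))
              (adj? (punchIn ℓ u) ℓ) (u ≟ p)))

  -- A walk enters and leaves `ℓ` through its only neighbour, so each visit to `ℓ` can be cut out.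
  deleteLeaf-connected : Connected T → Connected (deleteVertex T ℓ)
  deleteLeaf-connected connected u v = go u (connected (punchIn ℓ u) (punchIn ℓ v)) refl refl
    where
    go : ∀ u {x y} → Star Adj x y → x ≡ punchIn ℓ u → y ≡ punchIn ℓ v →
         Star (SimpleGraph.Adj (deleteVertex T ℓ)) u v
    go u ε refl e rewrite punchIn-injective ℓ u v e = ε
    go u (_◅_ {j = z} a rest) refl refl with punchView ℓ z
    ... | punched w = a ◅ go w rest refl refl
    ... | same      = detour rest refl
      where
      detour : ∀ {y} → Star Adj ℓ y → y ≡ punchIn ℓ v → Star (SimpleGraph.Adj (deleteVertex T ℓ)) u v
      detour ε e = contradiction (sym e) (punchInᵢ≢i ℓ v)
      detour (_◅_ {j = z} b rest) e with punchView ℓ z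
      ... | same = contradiction b (loopless refl)
      ... | punched w = go u rest (cong (punchIn ℓ) (trans (to (leaf w) b) (sym (to (leaf u) (adj-sym a))))) e

  deleteLeaf-isTree : IsTree T → IsTree (deleteVertex T ℓ)
  deleteLeaf-isTree (connected , acyclic) = deleteLeaf-connected connected ,
    λ len c (injective , consecutive , closing) → acyclic len (punchIn ℓ ∘ c)
      ((λ e → injective (punchIn-injective ℓ _ _ e)) , consecutive , closing)

module _ (T : SimpleGraph n) where
  open SimpleGraph T

  -- A path of the graph in the usual sense, since no vertex repeats.
  IsTrail : (Fin m → Fin n) → Set
  IsTrail c = Injective _≡_ _≡_ c × (∀ i j → toℕ j ≡ suc (toℕ i) → Adj (c i) (c j))

  extendTrail : (c : Fin (suc m) → Fin n) → IsTrail c → ∀ v → Adj v (c zero) → (∀ j → c j ≢ v) →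
                IsTrail (v ∷ c)
  extendTrail c (injective , consecutive) v v~c₀ v∉c = injective′ , consecutive′
    where
    injective′ : Injective _≡_ _≡_ (v ∷ c)
    injective′ {zero}  {zero}  e = refl
    injective′ {zero}  {suc j} e = contradiction (sym e) (v∉c j)
    injective′ {suc i} {zero}  e = contradiction e (v∉c i)
    injective′ {suc i} {suc j} e = cong suc (injective e)
    consecutive′ : ∀ i j → toℕ j ≡ suc (toℕ i) → Adj ((v ∷ c) i) ((v ∷ c) j)
    consecutive′ zero    (suc zero) e = v~c₀
    consecutive′ (suc i) (suc j)    e = consecutive i j (suc-injective e)

  -- The edge from the front to position `j + 2` closes the initial segment of the trail into a
  -- cycle of length `3 + j`.
  closeTrail : (c : Fin (2 + m) → Fin n) → IsTrail c → (j : Fin m) → Adj (c (suc (suc j))) (c zero) →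
               ¬ Acyclic T
  closeTrail {m} c (injective , consecutive) j closing acyclic = acyclic (toℕ j) (c ∘ ι)
    ((λ e → Fin.inject≤-injective bound bound _ _ (injective e)) ,
     (λ i → consecutive (ι (inject₁ i)) (ι (suc i))
       (trans (toℕ-ι (suc i)) (cong suc (sym (trans (toℕ-ι (inject₁ i)) (Fin.toℕ-inject₁ i)))))) ,
     subst₂ Adj
       (cong c (toℕ-injective (sym (trans (toℕ-ι (fromℕ (2 + toℕ j))) (Fin.toℕ-fromℕ (2 + toℕ j))))))
       (cong c (toℕ-injective (sym (toℕ-ι zero))))
       closing)
    where
    bound : 3 + toℕ j ≤ 2 + m
    bound = s≤s (s≤s (Fin.toℕ<n j))
    ι : Fin (3 + toℕ j) → Fin (2 + m)
    ι i = inject≤ i bound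
    toℕ-ι : ∀ i → toℕ (ι i) ≡ toℕ i
    toℕ-ι i = Fin.toℕ-inject≤ i bound

module _ (T : SimpleGraph (suc n)) (acyclic : Acyclic T) where
  open SimpleGraph T

  -- A trail that cannot be extended at its front starts at a leaf.
  trail⇒leaf : ∀ fuel {m} → suc n < fuel + (2 + m) → (c : Fin (2 + m) → Fin (suc n)) → IsTrail T c →
               ∃[ ℓ ] ∃[ p ] IsLeaf T ℓ p × ℓ ≢ c (fromℕ (suc m))
  -- Without fuel the trail would have more distinct vertices than the graph.
  trail⇒leaf zero       short c (injective , _) =
    contradiction (Fin.injective⇒≤ injective) (<⇒≱ short)
  trail⇒leaf (suc fuel) {m} short c trail@(injective , consecutive)
    with any? (λ v → adj? (c zero) v ×-dec ¬? (v ≟ c (suc zero)))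
  ... | no none = c zero , punchOut c₀≢c₁ , leaf , λ e → contradiction (injective e) λ ()
    where
    c₀≢c₁ : c zero ≢ c (suc zero)
    c₀≢c₁ e = contradiction (injective e) λ ()
    leaf : IsLeaf T (c zero) (punchOut c₀≢c₁)
    leaf v = mk⇔ unique λ { refl →
      subst (Adj (c zero)) (sym (punchIn-punchOut c₀≢c₁)) (consecutive zero (suc zero) refl) }
      where
      unique : Adj (c zero) (punchIn (c zero) v) → v ≡ punchOut c₀≢c₁
      unique a with punchIn (c zero) v ≟ c (suc zero)
      ... | yes e = punchIn-injective (c zero) _ _ (trans e (sym (punchIn-punchOut c₀≢c₁)))
      ... | no ne = contradiction (punchIn (c zero) v , a , ne) none
  -- A further neighbour `v` of the front either lies on the trail, giving a loop or a cycle, or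
  -- extends the trail; the end of the trail stays fixed.
  ... | yes (v , c₀~v , v≢c₁) with any? (λ j → c j ≟ v)
  ...   | yes (zero , refl)        = contradiction c₀~v (loopless refl)
  ...   | yes (suc zero , refl)    = contradiction refl v≢c₁
  ...   | yes (suc (suc j) , refl) = contradiction acyclic (closeTrail T c trail j (adj-sym c₀~v))
  ...   | no v∉c = trail⇒leaf fuel (subst (suc n <_) (sym (+-suc fuel (2 + m))) short) (v ∷ c)
                     (extendTrail T c trail v (adj-sym c₀~v) (λ j e → v∉c (j , e)))

-- Connectedness gives `u` a neighbour, and the trail from it to `u` is extended away from `u`.
-- Avoiding `u` allows a tree to be pruned down to any chosen root.
tree-leaf : (T : SimpleGraph (2 + n)) → IsTree T → ∀ u → ∃[ ℓ ] ∃[ p ] IsLeaf T ℓ p × ℓ ≢ u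
tree-leaf {n} T (connected , acyclic) u with connected u (punchIn u zero)
... | path = start path refl
  where
  open SimpleGraph T
  start : ∀ {v} → Star Adj u v → v ≡ punchIn u zero → ∃[ ℓ ] ∃[ p ] IsLeaf T ℓ p × ℓ ≢ u
  start ε e = contradiction (sym e) (punchInᵢ≢i u zero)
  -- Fuel `suc n` suffices for a trail of two vertices, as `2 + n` vertices are available.
  start (_◅_ {j = y} u~y _) _ = trail⇒leaf T acyclic (suc n) {0}
    (≤-reflexive (cong suc (+-comm 2 n))) (y ∷ u ∷ [])
    (extendTrail T (u ∷ []) ((λ { {zero} {zero} _ → refl }) , λ { zero zero () }) y (adj-sym u~y)
      (λ { zero e → loopless e u~y }))

-- Paths, and vertices of degree at least three

P-suc-adj : ∀ {i j : Fin n} → SimpleGraph.Adj (P n) i j ⇔ SimpleGraph.Adj (P (suc n)) (suc i) (suc j)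
P-suc-adj = mk⇔ (λ { (inj₁ e) → inj₁ (cong suc e) ; (inj₂ e) → inj₂ (cong suc e) })
                (λ { (inj₁ e) → inj₁ (suc-injective e) ; (inj₂ e) → inj₂ (suc-injective e) })

P-first-leaf : ∀ n → IsLeaf (P (2 + n)) zero zero
P-first-leaf n v = mk⇔ (λ { (inj₁ e) → toℕ-injective (suc-injective e) ; (inj₂ ()) }) (λ { refl → inj₁ refl })

path-interior : (i : Fin (suc n)) → i ≡ zero ⊎ i ≡ fromℕ n ⊎ 2 ≤ degree (P (suc n)) i
path-interior zero = inj₁ refl
path-interior {suc n} (suc i) with suc n ≟ℕ toℕ (suc i)
... | yes e = inj₂ (inj₁ (toℕ-injective (trans (sym e) (sym (Fin.toℕ-fromℕ (suc n))))))
... | no ne = inj₂ (inj₂ (≤-trans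
  (≤-reflexive (sym (cong₂ _+_ (𝟙-true (adj? (suc i) before) before-adj) (𝟙-true (adj? (suc i) after) after-adj))))
  (two-terms≤sum (λ v → 𝟙 (adj? (suc i) v)) before≢after)))
  where
  open SimpleGraph (P (2 + n))
  before after : Fin (2 + n)
  before = inject₁ i
  after  = suc (lower₁ (suc i) ne)
  before-adj : Adj (suc i) before
  before-adj = inj₂ (cong suc (sym (Fin.toℕ-inject₁ i)))
  after-adj : Adj (suc i) after
  after-adj = inj₁ (cong suc (Fin.toℕ-lower₁ (suc i) ne))
  before≢after : before ≢ after
  before≢after e = m≢1+n+m (toℕ i) {1} (trans (sym (Fin.toℕ-inject₁ i))
    (trans (cong toℕ e) (cong suc (Fin.toℕ-lower₁ (suc i) ne))))

punchIn-fromℕ : (i : Fin n) → punchIn (fromℕ n) i ≡ inject₁ i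
punchIn-fromℕ zero    = refl
punchIn-fromℕ (suc i) = cong suc (punchIn-fromℕ i)

degree-iso : (G : SimpleGraph n) (G′ : SimpleGraph m) (iso : G ≅ G′) →
             ∀ u → degree G u ≡ degree G′ (proj₁ iso ⟨$⟩ʳ u)
degree-iso G G′ (π , iso) u = trans
  (sum-cong-≗ λ v → 𝟙-cong (iso u v) (SimpleGraph.adj? G u v) (SimpleGraph.adj? G′ (π ⟨$⟩ʳ u) (π ⟨$⟩ʳ v)))
  (sym (∑-permute (λ v → 𝟙 (SimpleGraph.adj? G′ (π ⟨$⟩ʳ u) v)) π))

-- The isomorphism extends by `ℓ ↦ ℓ′`, since the attachment vertices correspond. This lengthens a
-- path at either end.
≅-from-leaves : (G G′ : SimpleGraph (suc n)) {ℓ ℓ′ : Fin (suc n)} {p p′ : Fin n} →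
  IsLeaf G ℓ p → IsLeaf G′ ℓ′ p′ → (iso : deleteVertex G ℓ ≅ deleteVertex G′ ℓ′) →
  proj₁ iso ⟨$⟩ʳ p ≡ p′ → G ≅ G′
≅-from-leaves G G′ {ℓ} {ℓ′} {p} {p′} leaf leaf′ (π , iso) πp≡p′ = σ , σ-iso
  where
  module G = SimpleGraph G
  module G′ = SimpleGraph G′
  σ = insert ℓ ℓ′ π
  σ-punchIn : ∀ v → σ ⟨$⟩ʳ punchIn ℓ v ≡ punchIn ℓ′ (π ⟨$⟩ʳ v)
  σ-punchIn = insert-punchIn ℓ ℓ′ π
  σ-ℓ : σ ⟨$⟩ʳ ℓ ≡ ℓ′
  σ-ℓ with ℓ ≟ ℓ
  ... | yes _ = refl
  ... | no ne = contradiction refl ne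
  leaf-iso : ∀ v → G.Adj ℓ (punchIn ℓ v) ⇔ G′.Adj ℓ′ (punchIn ℓ′ (π ⟨$⟩ʳ v))
  leaf-iso v = mk⇔
    (λ a → from (leaf′ _) (trans (cong (π ⟨$⟩ʳ_) (to (leaf v) a)) πp≡p′))
    (λ a → from (leaf v) (Injection.injective (↔⇒↣ π) (trans (to (leaf′ _) a) (sym πp≡p′))))
  σ-iso : ∀ u v → G.Adj u v ⇔ G′.Adj (σ ⟨$⟩ʳ u) (σ ⟨$⟩ʳ v)
  σ-iso u v with punchView ℓ u | punchView ℓ v
  ... | same | same = mk⇔ (λ a → contradiction a (G.loopless refl)) (λ a → contradiction a (G′.loopless refl))
  ... | same | punched v rewrite σ-ℓ | σ-punchIn v = leaf-iso v
  ... | punched u | same rewrite σ-ℓ | σ-punchIn u =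
    mk⇔ (λ a → G′.adj-sym (to (leaf-iso u) (G.adj-sym a))) (λ a → G.adj-sym (from (leaf-iso u) (G′.adj-sym a)))
  ... | punched u | punched v rewrite σ-punchIn u | σ-punchIn v = iso u v

-- Induction by deleting a leaf. A branching vertex of the rest stays branching. If the rest is a
-- path, the leaf is attached at an end, giving a longer path, or at an interior vertex, whose
-- degree rises from at least two to at least three.
tree-path-or-branching : ∀ n (T : SimpleGraph (suc n)) → IsTree T → T ≅ P (suc n) ⊎ ∃[ u ] 3 ≤ degree T u
tree-path-or-branching zero T tree = inj₁ (Perm.id , λ
  { zero zero → mk⇔ (λ a → contradiction a (SimpleGraph.loopless T refl))
                    (λ { (inj₁ ()) ; (inj₂ ()) }) })
tree-path-or-branching (suc n) T tree with ℓ , p , leaf , _ ← tree-leaf T tree zero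
  with tree-path-or-branching n (deleteVertex T ℓ) (deleteLeaf-isTree T leaf tree)
... | inj₂ (u , branching) = inj₂ (punchIn ℓ u ,
  ≤-trans branching (≤-trans (m≤n+m _ (𝟙 (u ≟ p))) (≤-reflexive (sym (degree-deleteLeaf T leaf u)))))
... | inj₁ (π , iso) with path-interior (π ⟨$⟩ʳ p)
...   | inj₁ first = inj₁ (≅-from-leaves T (P (2 + n)) leaf (P-first-leaf n)
          (π , λ u v → mk⇔ (to P-suc-adj ∘ to (iso u v)) (from (iso u v) ∘ from P-suc-adj)) first)
...   | inj₂ (inj₁ last) = inj₁ (≅-from-leaves T (P (2 + n)) leaf last-leaf
          (π , λ u v → mk⇔ (adj-inject ∘ to (iso u v)) (from (iso u v) ∘ adj-inject⁻¹)) last)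
  where
  toℕ-punchIn : ∀ (i : Fin (suc n)) → toℕ (punchIn (fromℕ (suc n)) i) ≡ toℕ i
  toℕ-punchIn i = trans (cong toℕ (punchIn-fromℕ i)) (Fin.toℕ-inject₁ i)
  last-leaf : IsLeaf (P (2 + n)) (fromℕ (suc n)) (fromℕ n)
  last-leaf v = mk⇔
    (λ { (inj₁ e) → contradiction (trans (sym (toℕ-punchIn v)) (trans e (cong suc (Fin.toℕ-fromℕ (suc n)))))
                      (<⇒≢ (<-trans (Fin.toℕ<n v) (n<1+n (suc n))))
       ; (inj₂ e) → toℕ-injective (suc-injective (sym (trans e (cong suc (toℕ-punchIn v))))) })
    (λ { refl → inj₂ (cong suc (sym (toℕ-punchIn (fromℕ n)))) })
  adj-inject : ∀ {i j} → SimpleGraph.Adj (P (suc n)) i j →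
    SimpleGraph.Adj (P (2 + n)) (punchIn (fromℕ (suc n)) i) (punchIn (fromℕ (suc n)) j)
  adj-inject {i} {j} a rewrite toℕ-punchIn i | toℕ-punchIn j = a
  adj-inject⁻¹ : ∀ {i j} → SimpleGraph.Adj (P (2 + n)) (punchIn (fromℕ (suc n)) i) (punchIn (fromℕ (suc n)) j) →
    SimpleGraph.Adj (P (suc n)) i j
  adj-inject⁻¹ {i} {j} a rewrite toℕ-punchIn i | toℕ-punchIn j = a
...   | inj₂ (inj₂ interior) = inj₂ (punchIn ℓ p , ≤-trans (s≤s (≤-trans interior
          (≤-reflexive (sym (degree-iso (deleteVertex T ℓ) (P (suc n)) (π , iso) p)))))
          (≤-reflexive (sym (trans (degree-deleteLeaf T leaf p)
            (cong (_+ degree (deleteVertex T ℓ) p) (𝟙-true (p ≟ p) refl))))))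

-- Counting colorings of a tree

module TreeColorings {h} (H : Graph h) where
  open RootedColorings H
  private
    module H = Graph H

  coloring-cong : (G : SimpleGraph n) {f g : Fin n → Fin h} → f ≗ g → IsColoring G H f ⇔ IsColoring G H g
  coloring-cong G f≗g = mk⇔
    (λ col u v a → subst₂ H.Adj (f≗g u) (f≗g v) (col u v a))
    (λ col u v a → subst₂ H.Adj (sym (f≗g u)) (sym (f≗g v)) (col u v a))

  coloring-deleteLeaf : (T : SimpleGraph (suc n)) {ℓ : Fin (suc n)} {p : Fin n} → IsLeaf T ℓ p →
    (f : Fin (suc n) → Fin h) →
    IsColoring T H f ⇔ (IsColoring (deleteVertex T ℓ) H (f ∘ punchIn ℓ) × H.Adj (f (punchIn ℓ p)) (f ℓ))
  coloring-deleteLeaf T {ℓ} {p} leaf f = mk⇔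
    (λ col → (λ u v → col (punchIn ℓ u) (punchIn ℓ v)) , col (punchIn ℓ p) ℓ (adj-sym (from (leaf p) refl)))
    (λ (col , edge) → extend col edge)
    where
    open SimpleGraph T
    extend : IsColoring (deleteVertex T ℓ) H (f ∘ punchIn ℓ) → H.Adj (f (punchIn ℓ p)) (f ℓ) → IsColoring T H f
    extend col edge u v a with punchView ℓ u | punchView ℓ v
    ... | same      | same      = contradiction a (loopless refl)
    ... | punched u | punched v = col u v a
    ... | same      | punched v with refl ← to (leaf v) a = H.adj-sym edge
    ... | punched u | same      with refl ← to (leaf u) (adj-sym a) = edge

  coloring-insertLeaf : (T : SimpleGraph (suc n)) {ℓ : Fin (suc n)} {p : Fin n} → IsLeaf T ℓ p →
    ∀ f x → IsColoring T H (insertAt f ℓ x) ⇔ (IsColoring (deleteVertex T ℓ) H f × H.Adj (f p) x)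
  coloring-insertLeaf T {ℓ} {p} leaf f x = mk⇔
    (λ col → let (col′ , edge) = to (coloring-deleteLeaf T leaf (insertAt f ℓ x)) col in
             to (coloring-cong (deleteVertex T ℓ) restrict) col′ ,
             subst₂ H.Adj (restrict p) (insertAt-lookup f ℓ x) edge)
    (λ (col , edge) → from (coloring-deleteLeaf T leaf (insertAt f ℓ x))
             (from (coloring-cong (deleteVertex T ℓ) restrict) col ,
              subst₂ H.Adj (sym (restrict p)) (sym (insertAt-lookup f ℓ x)) edge))
    where
    restrict : ∀ v → insertAt f ℓ x (punchIn ℓ v) ≡ f v
    restrict = insertAt-punchIn f ℓ x

  -- For weights `colorings ∘ w` this counts the extensions of `f` to `G` with the rooted tree `w v`
  -- hung at each vertex `v`.
  coloringWeight : SimpleGraph n → (Fin n → Weight) → (Fin n → Fin h) → ℕ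
  coloringWeight G w f = 𝟙 (isColoring? G H f) * product (λ v → w v (f v))

  coloringWeight-cong : (G : SimpleGraph n) (w : Fin n → Weight) → Extensional (coloringWeight G w)
  coloringWeight-cong G w {f} {g} f≗g = cong₂ _*_
    (𝟙-cong (coloring-cong G f≗g) (isColoring? G H f) (isColoring? G H g))
    (product-cong λ v → cong (w v) (f≗g v))

  weightedHom : SimpleGraph n → (Fin n → Weight) → ℕ
  weightedHom {n} G w = sumMaps n (coloringWeight G w)

  hom-weighted : (G : SimpleGraph n) → hom G H ≡ weightedHom G (λ _ → one)
  hom-weighted {n} G = begin
    hom G H                                            ≡⟨ #Fin-as-sum {h ^ n} (λ c → isColoring? G H (finToFun c)) ⟩
    sum {h ^ n} (λ c → 𝟙 (isColoring? G H (finToFun c)))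
      ≡⟨ sum-cong-≗ {h ^ n} (λ c → sym (trans (cong (𝟙 (isColoring? G H (finToFun c)) *_) (product-replicate-one n))
                                            (*-identityʳ _))) ⟩
    sum {h ^ n} (λ c → coloringWeight G (λ _ → one) (finToFun c))
      ≡⟨ sum-finToFun n (coloringWeight G (λ _ → one)) (coloringWeight-cong G (λ _ → one)) ⟩
    weightedHom G (λ _ → one) ∎
    where open ≡-Reasoning

  graftLeaf-product : (w : Fin (suc n) → RootedTree) (ℓ : Fin (suc n)) (p : Fin n) (f : Fin n → Fin h) →
    product (λ v → colorings (graftLeaf w ℓ p v) (f v)) ≡
    step (colorings (w ℓ)) (f p) * product (λ v → colorings (w (punchIn ℓ v)) (f v))
  graftLeaf-product {n} w ℓ p f = begin
    product (λ v → colorings (graftLeaf w ℓ p v) (f v))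
      ≡⟨ (product-cong λ v → split (does (v ≟ p)) (w ℓ) (w (punchIn ℓ v)) (f v)) ⟩
    product {n} (λ v → (if does (v ≟ p) then step (colorings (w ℓ)) (f v) else 1) * colorings (w (punchIn ℓ v)) (f v))
      ≡⟨ product-distrib-* (λ v → if does (v ≟ p) then step (colorings (w ℓ)) (f v) else 1) rest ⟩
    product {n} (λ v → if does (v ≟ p) then step (colorings (w ℓ)) (f v) else 1) * product rest
      ≡⟨ cong (_* product rest) (sum-single *-1-commutativeMonoid p (λ v → step (colorings (w ℓ)) (f v))) ⟩
    step (colorings (w ℓ)) (f p) * product rest ∎
    where
    open ≡-Reasoning
    rest : Fin n → ℕ
    rest v = colorings (w (punchIn ℓ v)) (f v)
    split : ∀ b s t x → colorings (if b then graft s t else t) x ≡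
                        (if b then step (colorings s) x else 1) * colorings t x
    split true  s t x = refl
    split false s t x = sym (+-identityʳ _)

  -- Only the edge to `p` constrains the color of `ℓ`. Summing over that color therefore applies
  -- `step` to the weight of `ℓ` and leaves a factor at `p`, as grafting does.
  weightedHom-deleteLeaf : (T : SimpleGraph (suc n)) {ℓ : Fin (suc n)} {p : Fin n} → IsLeaf T ℓ p →
    (w : Fin (suc n) → RootedTree) →
    weightedHom T (colorings ∘ w) ≡ weightedHom (deleteVertex T ℓ) (colorings ∘ graftLeaf w ℓ p)
  weightedHom-deleteLeaf {n} T {ℓ} {p} leaf w = begin
    weightedHom T W
      ≡⟨ sumMaps-insertAt ℓ (coloringWeight T W) (coloringWeight-cong T W) ⟩
    ∑[ x < h ] sumMaps n (λ f → coloringWeight T W (insertAt f ℓ x))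
      ≡⟨ sumMaps-comm-sum n (λ x f → coloringWeight T W (insertAt f ℓ x)) ⟩
    sumMaps n (λ f → ∑[ x < h ] coloringWeight T W (insertAt f ℓ x))
      ≡⟨ sumMaps-cong n sum-over-leaf ⟩
    weightedHom (deleteVertex T ℓ) (colorings ∘ graftLeaf w ℓ p) ∎
    where
    open ≡-Reasoning
    open import Algebra.Properties.CommutativeSemigroup *-commutativeSemigroup using (interchange)
    W : Fin (suc n) → Weight
    W = colorings ∘ w
    rest : (Fin n → Fin h) → ℕ
    rest f = product (λ v → W (punchIn ℓ v) (f v))
    col? : ∀ f → Dec (IsColoring (deleteVertex T ℓ) H f)
    col? f = isColoring? (deleteVertex T ℓ) H f
    product-insertAt : ∀ f x → product (λ v → W v (insertAt f ℓ x v)) ≡ W ℓ x * rest f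
    product-insertAt f x = trans (product-remove {i = ℓ} (λ v → W v (insertAt f ℓ x v)))
      (cong₂ _*_ (cong (W ℓ) (insertAt-lookup f ℓ x))
                 (product-cong λ v → cong (W (punchIn ℓ v)) (insertAt-punchIn f ℓ x v)))
    term : ∀ f x → coloringWeight T W (insertAt f ℓ x) ≡ 𝟙 (col? f) * rest f * (𝟙 (H.adj? (f p) x) * W ℓ x)
    term f x = begin
      𝟙 (isColoring? T H (insertAt f ℓ x)) * product (λ v → W v (insertAt f ℓ x v))
        ≡⟨ cong₂ _*_ (trans (𝟙-cong (coloring-insertLeaf T leaf f x) (isColoring? T H (insertAt f ℓ x))
                                     (col? f ×-dec H.adj? (f p) x))
                            (𝟙-× (col? f) (H.adj? (f p) x)))
                     (trans (product-insertAt f x) (*-comm (W ℓ x) (rest f))) ⟩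
      𝟙 (col? f) * 𝟙 (H.adj? (f p) x) * (rest f * W ℓ x)
        ≡⟨ interchange (𝟙 (col? f)) (𝟙 (H.adj? (f p) x)) (rest f) (W ℓ x) ⟩
      𝟙 (col? f) * rest f * (𝟙 (H.adj? (f p) x) * W ℓ x) ∎
    sum-over-leaf : ∀ f → ∑[ x < h ] coloringWeight T W (insertAt f ℓ x) ≡
                          coloringWeight (deleteVertex T ℓ) (colorings ∘ graftLeaf w ℓ p) f
    sum-over-leaf f = begin
      ∑[ x < h ] coloringWeight T W (insertAt f ℓ x)              ≡⟨ sum-cong-≗ (term f) ⟩
      ∑[ x < h ] (𝟙 (col? f) * rest f * (𝟙 (H.adj? (f p) x) * W ℓ x))
        ≡⟨ *-distribˡ-sum (𝟙 (col? f) * rest f) (λ x → 𝟙 (H.adj? (f p) x) * W ℓ x) ⟨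
      𝟙 (col? f) * rest f * step (W ℓ) (f p)                      ≡⟨ *-assoc (𝟙 (col? f)) (rest f) _ ⟩
      𝟙 (col? f) * (rest f * step (W ℓ) (f p))
        ≡⟨ cong (𝟙 (col? f) *_) (trans (*-comm (rest f) _) (sym (graftLeaf-product w ℓ p f))) ⟩
      coloringWeight (deleteVertex T ℓ) (colorings ∘ graftLeaf w ℓ p) f ∎

  -- Leaves other than `u` are deleted until only `u` remains, while `w` collects what was cut off.
  -- An arbitrary `w` keeps the induction going, and each lost edge at `u` reappears in the root
  -- degree.
  tree-as-rootedTree : ∀ n (T : SimpleGraph (suc n)) → IsTree T → ∀ u (w : Fin (suc n) → RootedTree) →
    ∃[ t ] edges t ≡ n + sum (edges ∘ w) × rootDegree t ≡ rootDegree (w u) + degree T u ×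
           weightedHom T (colorings ∘ w) ≡ ⟨ one , colorings t ⟩
  tree-as-rootedTree zero T tree zero w = w zero , sym (+-identityʳ _) ,
    sym (trans (cong (rootDegree (w zero) +_) (cong (_+ 0) (𝟙-false (adj? zero zero) (loopless refl))))
               (+-identityʳ _)) ,
    sum-cong-≗ λ x → cong₂ _*_
      (𝟙-true (isColoring? T H (x ∷ [])) (λ { zero zero a → contradiction a (loopless refl) }))
      (*-identityʳ (colorings (w zero) x))
    where open SimpleGraph T
  tree-as-rootedTree (suc n) T tree u w with ℓ , p , leaf , ℓ≢u ← tree-leaf T tree u with punchView ℓ u
  ... | same = contradiction refl ℓ≢u
  ... | punched u
    with t , t-edges , t-degree , t-hom ←
      tree-as-rootedTree n (deleteVertex T ℓ) (deleteLeaf-isTree T leaf tree) u (graftLeaf w ℓ p) =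
    t ,
    trans t-edges (trans (cong (n +_) (graftLeaf-edges w ℓ p)) (+-suc n _)) ,
    trans t-degree (trans (cong (_+ degree (deleteVertex T ℓ) u) (graftLeaf-rootDegree w ℓ p u))
      (trans (+-assoc (rootDegree (w (punchIn ℓ u))) (𝟙 (u ≟ p)) _)
             (cong (rootDegree (w (punchIn ℓ u)) +_) (sym (degree-deleteLeaf T leaf u))))) ,
    trans (weightedHom-deleteLeaf T leaf w) t-hom

  -- Counting colorings of a path

  coloring-path-∷ : ∀ n f x →
    IsColoring (P (2 + n)) H (x ∷ f) ⇔ (IsColoring (P (suc n)) H f × H.Adj (f zero) x)
  coloring-path-∷ n f x = mk⇔
    (λ col → let (col′ , edge) = to leaf-removal col in (λ u v a → col′ u v (to P-suc-adj a)) , edge)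
    (λ (col , edge) → from leaf-removal ((λ u v a → col u v (from P-suc-adj a)) , edge))
    where leaf-removal = coloring-deleteLeaf (P (2 + n)) (P-first-leaf n) (x ∷ f)

  -- Summing out the first vertex turns weight `g` there into `step g` at the next. Taking `g` to be
  -- `one` gives all colorings, an indicator those with a prescribed color at the end.
  path-colorings : ∀ n g →
    sumMaps (suc n) (λ f → 𝟙 (isColoring? (P (suc n)) H f) * g (f zero)) ≡ ⟨ g , paths n ⟩
  path-colorings zero g = sum-cong-≗ λ x → trans
    (cong (_* g x) (𝟙-true (isColoring? (P 1) H (x ∷ []))
      (λ { zero zero a → contradiction a (SimpleGraph.loopless (P 1) refl) })))
    (*-comm 1 (g x))
  path-colorings (suc n) g = begin
    ∑[ x < h ] sumMaps (suc n) (λ f → 𝟙 (isColoring? (P (2 + n)) H (x ∷ f)) * g x)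
      ≡⟨ (sum-cong-≗ λ x → sumMaps-cong (suc n) λ f → trans
           (cong (_* g x) (trans (𝟙-cong (coloring-path-∷ n f x) (isColoring? (P (2 + n)) H (x ∷ f))
                                          (col? f ×-dec H.adj? (f zero) x))
                                 (𝟙-× (col? f) (H.adj? (f zero) x))))
           (*-assoc (𝟙 (col? f)) (𝟙 (H.adj? (f zero) x)) (g x))) ⟩
    ∑[ x < h ] sumMaps (suc n) (λ f → 𝟙 (col? f) * (𝟙 (H.adj? (f zero) x) * g x))
      ≡⟨ sumMaps-comm-sum (suc n) (λ x f → 𝟙 (col? f) * (𝟙 (H.adj? (f zero) x) * g x)) ⟩
    sumMaps (suc n) (λ f → ∑[ x < h ] (𝟙 (col? f) * (𝟙 (H.adj? (f zero) x) * g x)))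
      ≡⟨ sumMaps-cong (suc n) (λ f → *-distribˡ-sum (𝟙 (col? f)) (λ x → 𝟙 (H.adj? (f zero) x) * g x)) ⟨
    sumMaps (suc n) (λ f → 𝟙 (col? f) * step g (f zero))
      ≡⟨ path-colorings n (step g) ⟩
    ⟨ step g , paths n ⟩
      ≡⟨ step-self-adjoint g (paths n) ⟨
    ⟨ g , paths (suc n) ⟩ ∎
    where
    open ≡-Reasoning
    col? : ∀ f → Dec (IsColoring (P (suc n)) H f)
    col? = isColoring? (P (suc n)) H

  hom-path : ∀ n → hom (P (suc n)) H ≡ ⟨ one , paths n ⟩
  hom-path n = trans (hom-weighted (P (suc n))) (trans
    (sumMaps-cong (suc n) λ f → cong (𝟙 (isColoring? (P (suc n)) H f) *_) (product-replicate-one (suc n)))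
    (path-colorings n one))

  module _ (O : ClassOrdering H) where
    open ClassOrdering O

    homAt-path : ∀ n i → homAt (P (suc n)) zero i ≡ paths n (rep i)
    homAt-path n i = begin
      homAt (P (suc n)) zero i
        ≡⟨ #Fin-as-sum {h ^ suc n} (λ c → col? (finToFun c) ×-dec (finToFun {h} {suc n} c zero ≟ rep i)) ⟩
      sum {h ^ suc n} (λ c → 𝟙 (col? (finToFun c) ×-dec (finToFun {h} {suc n} c zero ≟ rep i)))
        ≡⟨ sum-cong-≗ {h ^ suc n} (λ c → 𝟙-× (col? (finToFun c)) (finToFun {h} {suc n} c zero ≟ rep i)) ⟩
      sum {h ^ suc n} (λ c → pinned (finToFun c))
        ≡⟨ sum-finToFun (suc n) pinned (λ {f} {g} f≗g → cong₂ _*_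
             (𝟙-cong (coloring-cong (P (suc n)) f≗g) (col? f) (col? g))
             (cong (λ x → 𝟙 (x ≟ rep i)) (f≗g zero))) ⟩
      sumMaps (suc n) pinned
        ≡⟨ path-colorings n (λ x → 𝟙 (x ≟ rep i)) ⟩
      ⟨ (λ x → 𝟙 (x ≟ rep i)) , paths n ⟩
        ≡⟨ sum-𝟙-≟ (rep i) (paths n) ⟩
      paths n (rep i) ∎
      where
      open ≡-Reasoning
      col? : ∀ f → Dec (IsColoring (P (suc n)) H f)
      col? = isColoring? (P (suc n)) H
      pinned : (Fin (suc n) → Fin h) → ℕ
      pinned f = 𝟙 (col? f) * 𝟙 (f zero ≟ rep i)

-- Trees other than paths have more colorings

corollary1p6 : ∀ {h} (H : Graph h) (O : ClassOrdering H) →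
    let open ClassOrdering O in
    IncreasingColumns similarityMatrix →
    -- t and s below stand for the numbers 2 + t and 2 + s of vertices.
    (∀ (t : ℕ) → Σ[ a ∈ Fin k ] Σ[ b ∈ Fin k ]
      (Σ[ f ∈ (Fin (2 + t) → Fin h) ]
        (IsColoring (P (2 + t)) H f × class (f zero) ≡ a × class (f (fromℕ (1 + t))) ≡ b)) ×
      (∀ (s : ℕ) → homAt (P (2 + s)) zero b > homAt (P (2 + s)) zero a)) →
    StronglyHoffmanLondon H
corollary1p6 {h} H O increasing ends (suc n) (s≤s _) T tree not-path
  with tree-path-or-branching n T tree
... | inj₁ path = contradiction path not-path
... | inj₂ (u , branching)
  with t , t-edges , t-degree , t-hom ←
    TreeColorings.tree-as-rootedTree H n T tree u (λ _ → point) = begin-strict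
    hom (P (suc n)) H           ≡⟨ hom-path n ⟩
    -- `t` has `n` edges, since the points hung at the start contribute none.
    ⟨ one , paths n ⟩           ≡⟨ cong (λ e → ⟨ one , paths e ⟩)
                                     (trans t-edges (trans (cong (n +_) (sum-replicate-zero (suc n)))
                                                            (+-identityʳ n))) ⟨
    ⟨ one , paths (edges t) ⟩   <⟨ colorings->-paths separated t (subst (3 ≤_) (sym t-degree) branching) ⟩
    ⟨ one , colorings t ⟩       ≡⟨ trans (hom-weighted T) t-hom ⟨
    hom T H                     ∎
  where
  open ≤-Reasoning
  open RootedColorings H
  open TreeColorings H
  open MonotoneColorings H O increasing
  open ClassOrdering O
  -- `2 + m` vertices make `m + 1` edges, so the coloring at index `m` gives a walk counted by
  -- `kernel (suc m)`. Its ends need not be class representatives, but path counts are constant on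
  -- classes.
  separated : ∀ m → ∃[ x ] ∃[ y ] 1 ≤ kernel (suc m) x y × (∀ l → paths (suc l) x < paths (suc l) y)
  separated m with a , b , (f , col , refl , refl) , gap ← ends m =
    f zero , f (fromℕ (suc m)) , kernel-positive (suc m) f (λ i j e → col i j (inj₁ e)) ,
    λ l → subst₂ _<_ (at-end l zero) (at-end l (fromℕ (suc m))) (gap l)
    where
    at-end : ∀ l i → homAt (P (2 + l)) zero (class (f i)) ≡ paths (suc l) (f i)
    at-end l i = trans (homAt-path O (suc l) (class (f i)))
      (sym (monotone-rep {paths (suc l)} (paths-monotone (suc l)) (f i)))
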